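{- Let $V(G)$ be a vertex set with distinguished vertices $s\neq t$ and let $n=|V(G)\setminus\{s,t\}|$. If $l\geq 2$ and $n\geq 2(l-1)^2$ then (1) $\left(\frac{n}{2(l-1)}\right)^{\lceil \lg l\rceil} \leq c(\mathcal{P}_{n,l}) \leq c(\mathcal{P}_{n,\leq l}) \leq n^{\lceil \lg l\rceil}+2$; (2) $n^{\frac14 \lg n-\frac12} \leq c(\mathcal{P}_n) \leq n^{\lg n+1}+2$.
   Context: $\lg$ is the base-2 logarithm. Fix a finite vertex set $V(G)$ with distinguished vertices $s,t$. Input graphs are directed graphs with vertex set $V(G)$. A monotone switching network is a tuple $\langle G',s',t',\mu'\rangle$ where $G'$ is an undirected multigraph with distinguished vertices $s',t'$, and $\mu'$ assigns to each edge of $G'$ a label of the form $v_1\to v_2$ with $v_1\neq v_2$ in $V(G)$. It accepts an input graph $G$ if there is a path in $G'$ from $s'$ to $t'$ all of whose edge labels are edges of $G$. Its size is $|V(G')|$. A knowledge set $K$ is a set of directed edges $u\to v$ with $u\neq v$ in $V(G)$. The modified certain knowledge game has the following moves on a knowledge set $K$: (i) if we directly see that $v_1\to v_2\in E(G)$, add or remove $v_1\to v_2$ from $K$; (ii) if $v_3\to v_4$ and $v_4\to v_5$ are both in $K$ and $v_3\neq v_5$, add or remove $v_3\to v_5$ from $K$; (iii) if $s\to t\in K$, add or remove any other edge from $K$. A certain knowledge switching network is a monotone switching network $G'$ for which one can assign a knowledge set $K_{v'}$ to each $v'\in V(G')$ such that: $K_{s'}=\{\}$; $K_{t'}$ contains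 a path from $s$ to $t$; and whenever there is an edge with label $e$ between $v'$ and $w'$ in $G'$, one can go from $K_{v'}$ to $K_{w'}$ by a sequence of moves of the modified certain knowledge game using only the knowledge that $e\in E(G)$ (i.e. moves of type (i) are only used for the edge $e$). For a set $I$ of input graphs, each containing a directed path from $s$ to $t$, $c(I)$ is the smallest size of a certain knowledge switching network accepting every graph in $I$. $\mathcal{P}_{n,l}$ is the set of input graphs $G$ with $E(G)=\{v_0\to v_1,\dots,v_{l-1}\to v_l\}$, where $v_0=s$, $v_l=t$ and $v_0,\dots,v_l$ are distinct vertices of $V(G)$. $\mathcal{P}_{n,\leq l}=\bigcup_{j=1}^{l}\mathcal{P}_{n,j}$ and $\mathcal{P}_n=\mathcal{P}_{n,\leq n+1}$. -}

module Defs where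

open import Algebra.Bundles using (CommutativeRing)
import Algebra.Properties.Semiring.Exp as Exp
open import Data.Bool.Base using (Bool; false; T)
open import Data.Fin.Base using (Fin; zero; suc; fromℕ; inject₁)
open import Data.Fin.Subset using (⁅_⁆; _∪_; ∁; ∣_∣)
open import Data.Integer.Base using (ℤ; +_; -[1+_])
open import Data.List.Base using (List)
open import Data.List.Membership.Propositional using (_∈_)
open import Data.Nat.Base as ℕ using (ℕ; zero; suc; NonZero; z≤n; s≤s)
open import Data.Product.Base using (Σ-syntax; ∃-syntax; _×_; _,_)
open import Data.Rational.Base as ℚ using (ℚ; 0ℚ; 1ℚ; ↥_; ↧ₙ_)
open import Data.Rational.Properties using (+-*-commutativeRing)
open import Data.Sum.Base using (_⊎_)
open import Function.Bundles using (_⇔_)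
open import Function.Definitions using (Injective)
open import Level using (0ℓ)
open import Relation.Binary.Core using (Rel)
open import Relation.Binary.Construct.Closure.ReflexiveTransitive using (Star)
open import Relation.Binary.PropositionalEquality using (_≡_; _≢_)
open import Relation.Nullary.Negation.Core using (¬_)
open import Relation.Unary using (Pred)

infix 4 _∈ₑ_ _∋_⟶_ _<ᶜ_ _≤ᶜ_
infixl 6 _+ᶜ_
infixr 7 _·ᶜ_
infixr 8 _^ᶜ_ _^ℚ_

record Edge (N : ℕ) : Set where
  constructor edge
  field
    src tgt  : Fin N
    .src≢tgt : src ≢ tgt

open Edge public

EdgeSet : ℕ → Set
EdgeSet N = Edge N → Bool

_∈ₑ_ : ∀ {N} → Edge N → EdgeSet N → Set
e ∈ₑ K = T (K e)

_∋_⟶_ : ∀ {N} → EdgeSet N → Fin N → Fin N → Set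
K ∋ u ⟶ v = ∃[ e ] (e ∈ₑ K × src e ≡ u × tgt e ≡ v)

-- An input graph is its set of edges.  Loops are omitted: labels of
-- switching networks are never loops, so they cannot affect acceptance.
InputGraph : ℕ → Set
InputGraph = EdgeSet

KnowledgeSet : ℕ → Set
KnowledgeSet = EdgeSet

#V∖[_,_] : ∀ {N} → Fin N → Fin N → ℕ
#V∖[ s , t ] = ∣ ∁ (⁅ s ⁆ ∪ ⁅ t ⁆) ∣

Added : ∀ {N} → Edge N → Rel (KnowledgeSet N) 0ℓ
Added f K K′ = ∀ e → e ∈ₑ K′ ⇔ (e ∈ₑ K ⊎ e ≡ f)

Removed : ∀ {N} → Edge N → Rel (KnowledgeSet N) 0ℓ
Removed f K K′ = ∀ e → e ∈ₑ K′ ⇔ (e ∈ₑ K × e ≢ f)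

AddedOrRemoved : ∀ {N} → Edge N → Rel (KnowledgeSet N) 0ℓ
AddedOrRemoved f K K′ = Added f K K′ ⊎ Removed f K K′

-- A single move when the only edge that can be directly seen is `seen`.
data Move {N} (s t : Fin N) (seen : Edge N) (K K′ : KnowledgeSet N) : Set where
  see        : AddedOrRemoved seen K K′ → Move s t seen K K′
  transitive : ∀ {v₄} (f : Edge N) →
               K ∋ src f ⟶ v₄ → K ∋ v₄ ⟶ tgt f →
               AddedOrRemoved f K K′ → Move s t seen K K′
  goal       : ∀ (f : Edge N) →
               K ∋ s ⟶ t → ¬ (src f ≡ s × tgt f ≡ t) →
               AddedOrRemoved f K K′ → Move s t seen K K′

-- An undirected multigraph is a list of labelled edges, each stored with an
-- arbitrary order of its endpoints; `Adjacent` forgets that order.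
record SwitchingNetwork (N : ℕ) : Set where
  field
    size  : ℕ
    s′ t′ : Fin size
    edges : List (Fin size × Edge N × Fin size)

  Adjacent : Fin size → Edge N → Fin size → Set
  Adjacent v e w = (v , e , w) ∈ edges ⊎ (w , e , v) ∈ edges

  Accepts : InputGraph N → Set
  Accepts G = Star (λ v w → ∃[ e ] (Adjacent v e w × e ∈ₑ G)) s′ t′

open SwitchingNetwork public using (size; Accepts)

IsCertainKnowledge : ∀ {N} → Fin N → Fin N → SwitchingNetwork N → Set
IsCertainKnowledge {N} s t G′ =
  Σ[ K ∈ (Fin size′ → KnowledgeSet N) ]
    (∀ e → K s′ e ≡ false) ×
    Star (K t′ ∋_⟶_) s t ×
    (∀ v e w → Adjacent v e w → Star (Move s t e) (K v) (K w))
  where open SwitchingNetwork G′ renaming (size to size′)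

-- IsC s t I c: the number c(I) exists and equals c, i.e. c is the smallest
-- size of a certain knowledge switching network accepting every graph in I.
record IsC {N} (s t : Fin N) (I : Pred (InputGraph N) 0ℓ) (c : ℕ) : Set where
  field
    attained : ∃[ G′ ] (IsCertainKnowledge s t G′ ×
                        (∀ G → I G → Accepts G′ G) × size G′ ≡ c)
    minimal  : ∀ G′ → IsCertainKnowledge s t G′ →
               (∀ G → I G → Accepts G′ G) → c ℕ.≤ size G′

𝒫 : ∀ {N} → Fin N → Fin N → ℕ → Pred (InputGraph N) 0ℓ
𝒫 {N} s t l G =
  Σ[ v ∈ (Fin (suc l) → Fin N) ]
    Injective _≡_ _≡_ v ×
    v zero ≡ s ×
    v (fromℕ l) ≡ t ×
    (∀ e → e ∈ₑ G ⇔ (∃[ i ] (src e ≡ v (inject₁ i) × tgt e ≡ v (suc i))))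

𝒫≤ : ∀ {N} → Fin N → Fin N → ℕ → Pred (InputGraph N) 0ℓ
𝒫≤ s t l G = ∃[ j ] (1 ℕ.≤ j × j ℕ.≤ l × 𝒫 s t j G)

𝒫-all : ∀ {N} → Fin N → Fin N → Pred (InputGraph N) 0ℓ
𝒫-all s t = 𝒫≤ s t (#V∖[ s , t ] ℕ.+ 1)

open Exp (CommutativeRing.semiring +-*-commutativeRing) public using (_^_)

fromℕℚ : ℕ → ℚ
fromℕℚ n = + n ℚ./ 1

2[l-1]-nonZero : ∀ {l} → 2 ℕ.≤ l → NonZero (2 ℕ.* (l ℕ.∸ 1))
2[l-1]-nonZero (s≤s (s≤s z≤n)) = _

-- Real numbers as Dedekind cuts
--
-- `lower x q` means q < x and `upper x q` means x < q.  The cut axioms are not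
-- fields; every operation below is the usual one on genuine cuts, on the
-- domain indicated.

record Cut : Set₁ where
  constructor cut
  field
    lower upper : Pred ℚ 0ℓ

open Cut public

_<ᶜ_ : Cut → Cut → Set
x <ᶜ y = ∃[ q ] (upper x q × lower y q)

_≤ᶜ_ : Cut → Cut → Set
x ≤ᶜ y = ¬ (y <ᶜ x)

fromℚ : ℚ → Cut
fromℚ p = cut (ℚ._< p) (p ℚ.<_)

fromℕᶜ : ℕ → Cut
fromℕᶜ n = fromℚ (fromℕℚ n)

_+ᶜ_ : Cut → Cut → Cut
x +ᶜ y = cut
  (λ r → ∃[ p ] ∃[ q ] (lower x p × lower y q × r ≡ p ℚ.+ q))
  (λ r → ∃[ p ] ∃[ q ] (upper x p × upper y q × r ≡ p ℚ.+ q))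

-- Scaling by a positive rational.
_·ᶜ_ : ℚ → Cut → Cut
a ·ᶜ x = cut
  (λ r → ∃[ p ] (lower x p × r ≡ a ℚ.* p))
  (λ r → ∃[ p ] (upper x p × r ≡ a ℚ.* p))

-- Comparison of x ∈ ℚ with b to an integer power, for b ≥ 1; a negative power
-- is moved to the other side.
_<[_^ᶻ_] : ℚ → ℕ → ℤ → Set
x <[ b ^ᶻ + k      ] = x ℚ.< fromℕℚ b ^ k
x <[ b ^ᶻ -[1+ k ] ] = x ℚ.* fromℕℚ b ^ suc k ℚ.< 1ℚ

[_^ᶻ_]<_ : ℕ → ℤ → ℚ → Set
[ b ^ᶻ + k      ]< x = fromℕℚ b ^ k ℚ.< x
[ b ^ᶻ -[1+ k ] ]< x = 1ℚ ℚ.< x ℚ.* fromℕℚ b ^ suc k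

-- b to a rational power p = a / d, for b ≥ 1: a positive r lies below
-- (above) it iff r ^ d lies below (above) b ^ a.
_^ℚ_ : ℕ → ℚ → Cut
b ^ℚ p = cut
  (λ r → r ℚ.≤ 0ℚ ⊎ (r ^ ↧ₙ p) <[ b ^ᶻ ↥ p ])
  (λ r → 0ℚ ℚ.< r × [ b ^ᶻ ↥ p ]< (r ^ ↧ₙ p))

-- The base-2 logarithm of n ≥ 1: p < lg n iff 2 ^ p < n.
lg : ℕ → Cut
lg n = cut
  (λ p → upper (2 ^ℚ p) (fromℕℚ n))
  (λ p → lower (2 ^ℚ p) (fromℕℚ n))

-- b to a real power, for b ≥ 1, as the supremum (infimum) of the powers of b
-- with smaller (larger) rational exponent.
_^ᶜ_ : ℕ → Cut → Cut
b ^ᶜ x = cut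
  (λ r → ∃[ p ] (lower x p × lower (b ^ℚ p) r))
  (λ r → ∃[ p ] (upper x p × upper (b ^ℚ p) r))

{-# OPTIONS --safe #-}
-- Upper bounds.  Bennett's reversible pebbling reaches distance 2^k with k
-- pebbles, so knowledge sets {s → v : v ∈ V} with |V| ≤ k suffice for paths of
-- length at most 2^k.
--
-- Lower bounds.  Along an accepting walk for a path of length l > 2^k some
-- vertex carries a knowledge set that speaks only about vertices of the path
-- and mentions at least k + 1 inner ones (an induction that splits an interval
-- of 2^(k+1) inner vertices into halves).  Cut the interior vertices into l − 1
-- layers of m each and consider the m^(l−1) paths through one vertex of every
-- layer: such a knowledge set fixes k + 1 of the choices, so each network
-- vertex serves at most m^(l−2−k) of these paths.
--
-- The minimum c(I) exists because solvability by a network of given size is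
-- decidable: everything involved ranges over finite sets.
--
-- For the lower bound in (2) take l − 1 = ⌊√(n/2)⌋.
module Submission where


-- The obstacle in the induction on halves: a walk with at most k + 1 mentioned vertices in the
-- whole interval may put all of them into one half, and for that half the hypothesis for k then
-- says nothing. At such a moment the other half is vacant, so what has to be carried along is that
-- a vacant half is never bridged by an edge. Reversibility supplies this: a bridge over a half that
-- starts vacant survives every walk covered by the hypothesis, and walks can be read backwards.
-- What happens outside an interval is arbitrary, so the hypothesis collapses each outer side to a
-- point and grants one further edge.
--
-- Origin of ¼ and ½ in (2): put r = l - 1 and K = ⌈lg (r + 1)⌉. From c ≥ (n / 2r)^K and (2r)² ≤ 2n
-- follows c⁴ ≥ (n / 2)^(2K), and n < 2 (r + 1)² ≤ 2 · 4^K gives 2K > lg n - 1, while (n / 2)^(lg n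
-- - 1) = 2 n^(lg n - 2).

-- The knowledge game along a single path

module LineGame where

  open import Data.Bool.Base using (Bool; true; false; T; if_then_else_)
  open import Data.Empty using (⊥-elim)
  open import Data.Nat.Base
  open import Data.Nat.Properties
  open import Relation.Binary.Definitions using (tri<; tri≈; tri>)
  open import Data.Product.Base using (∃-syntax; _×_; _,_; proj₁; proj₂)
  open import Data.Sum.Base using (_⊎_; inj₁; inj₂)
  open import Relation.Binary.Construct.Closure.ReflexiveTransitive using (Star; ε; _◅_; _◅◅_; reverse)
  import Relation.Binary.Construct.Closure.ReflexiveTransitive as Star
  open import Relation.Binary.PropositionalEquality
  open import Relation.Nullary.Negation.Core using (¬_)
  open import Relation.Nullary.Decidable.Core using (yes; no)

  bit : Bool → ℕ
  bit b = if b then 1 else 0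

  -- The number of x with a < x ≤ a + d in S.
  count : (ℕ → Bool) → ℕ → ℕ → ℕ
  count S a zero    = 0
  count S a (suc d) = bit (S (suc a)) + count S (suc a) d

  count-+ : ∀ S a d d′ → count S a (d + d′) ≡ count S a d + count S (a + d) d′
  count-+ S a zero d′ rewrite +-identityʳ a = refl
  count-+ S a (suc d) d′ rewrite count-+ S (suc a) d d′ | +-suc a d =
    sym (+-assoc (bit (S (suc a))) _ _)

  bit-T : ∀ {b} → T b → 1 ≤ bit b
  bit-T {true} _ = s≤s z≤n

  bit-mono : ∀ {b b′} → (T b → T b′) → bit b ≤ bit b′
  bit-mono {false}        _ = z≤n
  bit-mono {true} {true}  _ = ≤-refl
  bit-mono {true} {false} f = ⊥-elim (f _)

  count-mono : ∀ {S S′} a d →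
    (∀ {x} → a < x → x ≤ a + d → T (S x) → T (S′ x)) → count S a d ≤ count S′ a d
  count-mono a zero    f = z≤n
  count-mono a (suc d) f = +-mono-≤
    (bit-mono (f ≤-refl (m<m+n a (s≤s z≤n))))
    (count-mono (suc a) d λ a<x x≤ → f (<-trans ≤-refl a<x) (≤-trans x≤ (≤-reflexive (sym (+-suc a d)))))

  ∈⇒0<count : ∀ S a d {x} → a < x → x ≤ a + d → T (S x) → 0 < count S a d
  ∈⇒0<count S a zero a<x x≤ _ = ⊥-elim (<⇒≱ a<x (≤-trans x≤ (≤-reflexive (+-identityʳ a))))
  ∈⇒0<count S a (suc d) {x} a<x x≤ x∈ with x ≟ suc a
  ... | yes refl = ≤-trans (bit-T x∈) (m≤m+n _ _)
  ... | no  x≢   = ≤-trans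
    (∈⇒0<count S (suc a) d (≤∧≢⇒< a<x (≢-sym x≢)) (≤-trans x≤ (≤-reflexive (+-suc a d))) x∈)
    (m≤n+m _ _)

  count≡0⇒∉ : ∀ S a d {x} → count S a d ≡ 0 → a < x → x ≤ a + d → ¬ T (S x)
  count≡0⇒∉ S a d c≡0 a<x x≤ x∈ = <⇒≢ (∈⇒0<count S a d a<x x≤ x∈) (sym c≡0)

  -- A knowledge set about a path 0 → 1 → 2 → …: R is its set of edges, S the set
  -- of vertices it mentions (exactly so only on intervals where Exact holds).
  record State : Set₁ where
    field
      R    : ℕ → ℕ → Set
      S    : ℕ → Bool
      R⇒<  : ∀ {x y} → R x y → x < y
      src∈ : ∀ {x y} → R x y → T (S x)
      tgt∈ : ∀ {x y} → R x y → T (S y)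

  open State

  Seen : ℕ → (ℕ → ℕ → Set) → ℕ → ℕ → Set
  Seen i R x y = R x y ⊎ (x ≡ i × y ≡ suc i)

  Implies : ℕ → State → State → Set
  Implies i K K′ = ∀ {x y} → R K′ x y → Star (Seen i (R K)) x y

  -- Until s → t is known, the moves with label e preserve the transitive closure
  -- of K ∪ {e}.
  record Step (K K′ : State) : Set where
    constructor step
    field
      label : ℕ
      there : Implies label K K′
      back  : Implies label K′ K

  Exact : ℕ → ℕ → State → Set
  Exact a d K = ∀ {x} → a < x → x ≤ a + d → T (S K x) → ∃[ y ] (R K x y ⊎ R K y x)

  ∣_∣[_,_] : State → ℕ → ℕ → ℕ
  ∣ K ∣[ a , d ] = count (S K) a d

  record Small (a d k : ℕ) (K : State) : Set where
    constructor small
    field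
      exact   : Exact a d K
      count≤k : ∣ K ∣[ a , d ] ≤ k

  SmallStep : ℕ → ℕ → ℕ → State → State → Set
  SmallStep a d k K K′ = Small a d k K × Small a d k K′ × Step K K′

  Walk : ℕ → ℕ → ℕ → State → State → Set₁
  Walk a d k = Star (SmallStep a d k)

  Cross : ℕ → ℕ → State → Set
  Cross a d K = ∃[ x ] ∃[ y ] (x ≤ a × a + d < y × R K x y)

  Collapsed : ℕ → ℕ → (ℕ → ℕ → Set) → ℕ → ℕ → Set
  Collapsed a d R x y = (x ≤ a × y ≤ a) ⊎ (a + d < x × a + d < y) ⊎ R x y

  -- Once the vertices ≤ a are identified with each other, and so are those > a + d,
  -- seeing one more edge yields a path across the interval.
  Threat : ℕ → ℕ → State → Set
  Threat a d K = ∃[ i ] Star (Collapsed a d (Seen i (R K))) a (suc (a + d))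

  step-sym : ∀ {K K′} → Step K K′ → Step K′ K
  step-sym (step i f g) = step i g f

  walk-reverse : ∀ {a d k K K′} → Walk a d k K K′ → Walk a d k K′ K
  walk-reverse = reverse λ { (s , s′ , st) → s′ , s , step-sym st }

  walk-count : ∀ {a d k K K′} → Walk a d k K K′ → ∣ K ∣[ a , d ] ≤ k → ∣ K′ ∣[ a , d ] ≤ k
  walk-count ε                        c≤k = c≤k
  walk-count ((_ , small _ c≤k , _) ◅ w) _ = walk-count w c≤k

  seen⇒< : ∀ K {i x y} → Seen i (R K) x y → x < y
  seen⇒< K (inj₁ r)             = R⇒< K r
  seen⇒< K (inj₂ (refl , refl)) = ≤-refl

  path⇒≤ : ∀ K {i x y} → Star (Seen i (R K)) x y → x ≤ y
  path⇒≤ K ε        = ≤-refl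
  path⇒≤ K (e ◅ es) = <⇒≤ (<-≤-trans (seen⇒< K e) (path⇒≤ K es))

  -- `S` stays as it is: a crossing edge has both ends outside the interval, so neither `Exact` nor
  -- the count inside notices its removal.
  uncrossed : ℕ → ℕ → State → State
  uncrossed a d K = record
    { R    = λ x y → R K x y × ¬ (x ≤ a × a + d < y)
    ; S    = S K
    ; R⇒<  = λ (r , _) → R⇒< K r
    ; src∈ = λ (r , _) → src∈ K r
    ; tgt∈ = λ (r , _) → tgt∈ K r
    }

  -- An edge across the whole interval never helps to derive another edge inside it,
  -- so it can be dropped throughout a walk.
  module _ (a d : ℕ) where

    private
      U : State → State
      U = uncrossed a d

    uncrossed-path : ∀ K {i x y} → ¬ (x ≤ a × a + d < y) →
      Star (Seen i (R K)) x y → Star (Seen i (R (U K))) x y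
    uncrossed-path K nc ε = ε
    uncrossed-path K nc (inj₁ r ◅ es) =
      inj₁ (r , λ (x≤a , <z) → nc (x≤a , <-≤-trans <z (path⇒≤ K es)))
      ◅ uncrossed-path K (λ (z≤a , <y) → nc (<⇒≤ (<-≤-trans (R⇒< K r) z≤a) , <y)) es
    uncrossed-path K nc (inj₂ (refl , refl) ◅ es) =
      inj₂ (refl , refl)
      ◅ uncrossed-path K (λ (z≤a , <y) → nc (<⇒≤ z≤a , <y)) es

    uncrossed-step : ∀ {K K′} → Step K K′ → Step (U K) (U K′)
    uncrossed-step {K} {K′} (step i f g) =
      step i (λ (r , nc) → uncrossed-path K nc (f r)) (λ (r , nc) → uncrossed-path K′ nc (g r))

    uncrossed-small : ∀ {k K} → Small a d k K → Small a d k (U K)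
    uncrossed-small {k} {K} (small ex c≤) = small ex′ c≤
      where
      ex′ : Exact a d (U K)
      ex′ a<x x≤ x∈ with ex a<x x≤ x∈
      ... | y , inj₁ r = y , inj₁ (r , λ (x≤a , _) → <⇒≱ a<x x≤a)
      ... | y , inj₂ r = y , inj₂ (r , λ (_ , <x) → <⇒≱ <x x≤)

    uncrossed-walk : ∀ {k K K′} → Walk a d k K K′ → Walk a d k (U K) (U K′)
    uncrossed-walk = Star.gmap U λ (s , s′ , st) →
      uncrossed-small s , uncrossed-small s′ , uncrossed-step st

    path-or-cross : ∀ K {i x y} → Star (Seen i (R K)) x y → Star (Seen i (R (U K))) x y ⊎ Cross a d K
    path-or-cross K ε = inj₁ ε
    path-or-cross K (e ◅ es) with path-or-cross K es
    ... | inj₂ c = inj₂ c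
    path-or-cross K (inj₂ e ◅ es) | inj₁ es′ = inj₁ (inj₂ e ◅ es′)
    path-or-cross K {x = x} (_◅_ {j = z} (inj₁ r) es) | inj₁ es′ with x ≤? a | a + d <? z
    ... | yes x≤a | yes <z = inj₂ (x , z , x≤a , <z , r)
    ... | no x≰a  | _      = inj₁ (inj₁ (r , λ (x≤a , _) → x≰a x≤a) ◅ es′)
    ... | _       | no ≮z  = inj₁ (inj₁ (r , λ (_ , <z) → ≮z <z) ◅ es′)

    crossing-path⇒threat : ∀ K {i x y} → x ≤ a → a + d < y →
      Star (Seen i (R K)) x y → Threat a d K
    crossing-path⇒threat K {i} x≤a <y p =
      i , (inj₁ (≤-refl , x≤a) ◅ Star.map (λ e → inj₂ (inj₂ e)) p) ◅◅ (inj₂ (inj₁ (<y , ≤-refl)) ◅ ε)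

    -- Undoing the step derives the old crossing edge from `K′` and the label. If no edge on that
    -- derivation crosses, the derivation alone is a threat in `U K′`.
    step-cross : ∀ {K K′} → ¬ Threat a d (U K′) → Step K K′ → Cross a d K → Cross a d K′
    step-cross {K} {K′} nt (step i f g) (x , y , x≤a , <y , r) with path-or-cross K′ (g r)
    ... | inj₂ c = c
    ... | inj₁ p = ⊥-elim (nt (crossing-path⇒threat (U K′) x≤a <y p))

  -- Away from crossing edges, nothing is asked of `K₀` outside the interval, so the statement can
  -- be applied to one half in the middle of a longer walk.
  ThreatFree : ℕ → ℕ → Set₁
  ThreatFree d k = ∀ a {K₀ K} → ∣ K₀ ∣[ a , d ] ≡ 0 → ¬ Cross a d K₀ → Walk a d k K₀ K → ¬ Threat a d K

  -- With its crossing edges dropped the walk starts uncrossed, so the hypothesis excludes threats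
  -- along it, and `step-cross` hands a crossing edge from each state to the next.
  cross-preserved : ∀ {d k} → ThreatFree d k → ∀ a {K₀ K} →
    ∣ K₀ ∣[ a , d ] ≡ 0 → Walk a d k K₀ K → Cross a d K₀ → Cross a d K
  cross-preserved {d} {k} free a {K₀} c≡0 w = go ε w
    where
    go : ∀ {K K′} → Walk a d k K₀ K → Walk a d k K K′ → Cross a d K → Cross a d K′
    go pre ε cr = cr
    go pre (_◅_ {j = K′} st es) cr =
      go pre′ es (step-cross a d (free a c≡0 (λ (_ , _ , x≤a , <y , _ , nc) → nc (x≤a , <y)) (uncrossed-walk a d pre′))
                    (proj₂ (proj₂ st)) cr)
      where pre′ = pre ◅◅ (st ◅ ε)

  -- The one inner vertex is never mentioned, so a path over it needs a crossing edge or both path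
  -- edges at that vertex, and only one edge is seen. For the same reason no step creates a crossing
  -- edge.
  threat-free-base : ThreatFree 1 0
  threat-free-base a {K₀} {K} c≡0 nc w (i , p) =
    final w (cross-path K (empty w) p (inj₁ ≤-refl) ≤-refl)
    where
    a<c : a < a + 1
    a<c = ≤-reflexive (+-comm 1 a)
    c≡ : a + 1 ≡ suc a
    c≡ = +-comm a 1

    empty : ∀ {K} → Walk a 1 0 K₀ K → ¬ T (S K (suc a))
    empty {K} w = count≡0⇒∉ (S K) a 1 (n≤0⇒n≡0 (walk-count w (≤-reflexive c≡0))) ≤-refl a<c

    -- In the second alternative for `u` the seen edge has been spent on entering the inner vertex,
    -- and nothing leads out of it.
    cross-path : ∀ K {i u y} → ¬ T (S K (suc a)) → Star (Collapsed a 1 (Seen i (R K))) u y →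
      (u ≤ a ⊎ (u ≡ suc a × i ≡ a)) → a + 1 < y → Cross a 1 K
    cross-path K a∉ ε (inj₁ u≤a) <y = ⊥-elim (<⇒≱ <y (≤-trans u≤a (<⇒≤ a<c)))
    cross-path K a∉ ε (inj₂ (refl , _)) <y = ⊥-elim (<⇒≱ <y (≤-reflexive (sym c≡)))
    cross-path K a∉ (inj₁ (_ , z≤a) ◅ es) _ <y = cross-path K a∉ es (inj₁ z≤a) <y
    cross-path K a∉ (inj₂ (inj₁ (<u , _)) ◅ es) (inj₁ u≤a) <y = ⊥-elim (<⇒≱ <u (≤-trans u≤a (<⇒≤ a<c)))
    cross-path K a∉ (inj₂ (inj₁ (<u , _)) ◅ es) (inj₂ (refl , _)) <y = ⊥-elim (<⇒≱ <u (≤-reflexive (sym c≡)))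
    cross-path K a∉ (_◅_ {i = u} {j = z} (inj₂ (inj₂ (inj₁ r))) es) (inj₁ u≤a) <y with <-cmp z (suc a)
    ... | tri< z<a _ _ = cross-path K a∉ es (inj₁ (s≤s⁻¹ z<a)) <y
    ... | tri≈ _ refl _ = ⊥-elim (a∉ (tgt∈ K r))
    ... | tri> _ _ a<z = u , z , u≤a , ≤-trans (s≤s (≤-reflexive c≡)) a<z , r
    cross-path K a∉ (inj₂ (inj₂ (inj₁ r)) ◅ es) (inj₂ (refl , _)) <y = ⊥-elim (a∉ (src∈ K r))
    cross-path K a∉ (_◅_ {i = u} (inj₂ (inj₂ (inj₂ (refl , refl)))) es) (inj₁ u≤a) <y with u ≟ a
    ... | yes refl = cross-path K a∉ es (inj₂ (refl , refl)) <y
    ... | no u≢a   = cross-path K a∉ es (inj₁ (≤∧≢⇒< u≤a u≢a)) <y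
    cross-path K a∉ (inj₂ (inj₂ (inj₂ (refl , refl))) ◅ es) (inj₂ (u≡1+a , u≡a)) <y =
      ⊥-elim (1+n≢n (trans (sym u≡1+a) u≡a))

    final : ∀ {K} → Walk a 1 0 K₀ K → ¬ Cross a 1 K
    final w = go ε w nc
      where
      go : ∀ {K K′} → Walk a 1 0 K₀ K → Walk a 1 0 K K′ → ¬ Cross a 1 K → ¬ Cross a 1 K′
      go pre ε nc = nc
      go {K} pre (st@(_ , _ , step i f _) ◅ es) nc = go (pre ◅◅ (st ◅ ε)) es
        λ (x , y , x≤a , <y , r) → nc
          (cross-path K (empty pre) (Star.map (λ e → inj₂ (inj₂ e)) (f r)) (inj₁ x≤a) <y)

  module _ {a d : ℕ} {K K′ : State} (0<d : 0 < d) (st : Step K K′) where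

    private
      m : ℕ
      m = a + d

    open Step st

    -- An edge of `K` that starts at or before `m` also ends there, as the right half is neither
    -- mentioned nor crossed. So the new edge over the left half uses the seen edge from `m` to
    -- `suc m` and stops at `suc m`. That seen edge is of no use within the left part, so undoing
    -- the step must recover the old edges there from edges of `K′` alone, which therefore mention
    -- the same vertices.
    left-kept : (∀ {x} → m < x → x ≤ m + d → ¬ T (S K x)) → ¬ Cross m d K → Exact a d K → Cross a d K′ →
      T (S K′ (suc m)) × (∀ {x} → a < x → x ≤ m → T (S K x) → T (S K′ x))
    left-kept right-empty nc ex (x , y , x≤a , m<y , r) =
      subst (λ z → T (S K′ z)) (proj₂ crossing) (tgt∈ K′ r) , kept
      where
      confined : ∀ {u v} → R K u v → u ≤ m → v ≤ m
      confined {u} {v} r u≤m with v ≤? m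
      ... | yes v≤m = v≤m
      ... | no v≰m with v ≤? m + d
      ...   | yes v≤ = ⊥-elim (right-empty (≰⇒> v≰m) v≤ (tgt∈ K r))
      ...   | no v≰  = ⊥-elim (nc (u , v , u≤m , ≰⇒> v≰ , r))

      1+m∉ : ¬ T (S K (suc m))
      1+m∉ = right-empty ≤-refl (≤-trans (≤-reflexive (+-comm 1 m)) (+-monoʳ-≤ m 0<d))

      exit : ∀ {u} → Star (Seen label (R K)) u y → u ≤ m → label ≡ m × y ≡ suc m
      exit ε u≤m = ⊥-elim (<⇒≱ m<y u≤m)
      exit (inj₁ r ◅ es) u≤m = exit es (confined r u≤m)
      exit {u} (inj₂ (refl , refl) ◅ es) u≤m with u ≟ m
      ... | no u≢m = exit es (≤∧≢⇒< u≤m u≢m)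
      ... | yes refl with es
      ...   | ε = refl , refl
      ...   | inj₁ r ◅ _ = ⊥-elim (1+m∉ (src∈ K r))
      ...   | inj₂ (1+m≡m , _) ◅ _ = ⊥-elim (1+n≢n 1+m≡m)

      crossing : label ≡ m × y ≡ suc m
      crossing = exit (there r) (≤-trans x≤a (m≤m+n a d))

      ends : ∀ {u v} → Star (Seen label (R K′)) u v → u < v → v ≤ m → T (S K′ u) × T (S K′ v)
      ends ε u<u _ = ⊥-elim (<-irrefl refl u<u)
      ends (inj₂ (refl , refl) ◅ es) _ v≤m =
        ⊥-elim (<⇒≱ (path⇒≤ K′ es) (≤-trans v≤m (≤-reflexive (sym (proj₁ crossing)))))
      ends (inj₁ r ◅ ε) _ _ = src∈ K′ r , tgt∈ K′ r
      ends (inj₁ r ◅ es@(e ◅ es′)) _ v≤m =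
        src∈ K′ r , proj₂ (ends es (<-≤-trans (seen⇒< K′ e) (path⇒≤ K′ es′)) v≤m)

      kept : ∀ {x} → a < x → x ≤ m → T (S K x) → T (S K′ x)
      kept a<x x≤m x∈ with ex a<x x≤m x∈
      ... | z , inj₁ r = proj₁ (ends (back r) (R⇒< K r) (confined r x≤m))
      ... | z , inj₂ r = proj₂ (ends (back r) (R⇒< K r) x≤m)

    -- Mirror image of `left-kept`: the new edge enters the right side through the seen edge, and
    -- since `K` does not mention `m` it has to start at `m`.
    right-kept : (∀ {x} → a < x → x ≤ m → ¬ T (S K x)) → ¬ Cross a d K → Exact m d K → Cross m d K′ →
      T (S K′ m) × (∀ {x} → m < x → x ≤ m + d → T (S K x) → T (S K′ x))
    right-kept left-empty nc ex (x , y , x≤m , c<y , r) =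
      subst (λ z → T (S K′ z)) (proj₂ crossing) (src∈ K′ r) , kept
      where
      confined : ∀ {u v} → R K u v → m < v → m < u
      confined {u} {v} r m<v with m <? u
      ... | yes m<u = m<u
      ... | no m≮u with a <? u
      ...   | yes a<u = ⊥-elim (left-empty a<u (≮⇒≥ m≮u) (src∈ K r))
      ...   | no a≮u  = ⊥-elim (nc (u , v , ≮⇒≥ a≮u , m<v , r))

      m∉ : ¬ T (S K m)
      m∉ = left-empty (m<m+n a 0<d) ≤-refl

      exit : ∀ {u} → Star (Seen label (R K)) u y → u ≤ m → label ≡ m × u ≡ m
      exit ε u≤m = ⊥-elim (<⇒≱ c<y (≤-trans u≤m (m≤m+n m d)))
      exit (_◅_ {j = z} (inj₁ r) es) u≤m with z ≤? m
      ... | no z≰m = ⊥-elim (<⇒≱ (confined r (≰⇒> z≰m)) u≤m)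
      ... | yes z≤m with exit es z≤m
      ...   | _ , refl = ⊥-elim (m∉ (tgt∈ K r))
      exit {u} (inj₂ (refl , refl) ◅ es) u≤m with u ≟ m
      ... | yes refl = refl , refl
      ... | no u≢m with exit es (≤∧≢⇒< u≤m u≢m)
      ...   | u≡m , _ = ⊥-elim (u≢m u≡m)

      crossing : label ≡ m × x ≡ m
      crossing = exit (there r) x≤m

      ends : ∀ {u v} → Star (Seen label (R K′)) u v → u < v → m < u → T (S K′ u) × T (S K′ v)
      ends ε u<u _ = ⊥-elim (<-irrefl refl u<u)
      ends (inj₂ (refl , refl) ◅ es) _ m<u = ⊥-elim (<⇒≢ m<u (sym (proj₁ crossing)))
      ends (inj₁ r ◅ ε) _ _ = src∈ K′ r , tgt∈ K′ r
      ends (inj₁ r ◅ es@(e ◅ es′)) _ m<u =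
        src∈ K′ r , proj₂ (ends es (<-≤-trans (seen⇒< K′ e) (path⇒≤ K′ es′)) (<-trans m<u (R⇒< K′ r)))

      kept : ∀ {x} → m < x → x ≤ m + d → T (S K x) → T (S K′ x)
      kept m<x x≤c x∈ with ex m<x x≤c x∈
      ... | z , inj₁ r = proj₁ (ends (back r) (R⇒< K r) m<x)
      ... | z , inj₂ r = proj₂ (ends (back r) (R⇒< K r) (confined r m<x))

  -- A half is good if walks that keep it small cannot make it vacant and crossed.
  -- It stays good: if it holds all k + 1 vertices, the other half is vacant, hence
  -- uncrossed, so the next step either leaves the full half in place (left-kept,
  -- right-kept) or leaves it uncrossed.
  Good : ℕ → ℕ → ℕ → State → Set₁
  Good a d k K = ∀ {K′} → ∣ K′ ∣[ a , d ] ≡ 0 → Walk a d k K K′ → ¬ Cross a d K′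

  -- The data needed to apply `ThreatFree d k` to this interval at `K`.
  record Anchored (a d k : ℕ) (K : State) : Set₁ where
    constructor anchored
    field
      {origin} : State
      vacant   : ∣ origin ∣[ a , d ] ≡ 0
      uncross  : ¬ Cross a d origin
      walk     : Walk a d k origin K

  -- The empty walk ends in a state that is not vacant, and a longer one would need `K` itself to be
  -- small.
  good-vacuous : ∀ {a d k K} → k < ∣ K ∣[ a , d ] → Good a d k K
  good-vacuous k< c≡0 ε = ⊥-elim (m<n⇒n≢0 k< c≡0)
  good-vacuous k< c≡0 ((small _ c≤k , _) ◅ _) = ⊥-elim (<⇒≱ k< c≤k)

  module _ {d k : ℕ} (free : ThreatFree d k) (0<d : 0 < d) (a : ℕ) where

    private
      m : ℕ
      m = a + d

      e : m + d ≡ a + (d + d)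
      e = +-assoc a d d

    -- The reversed walk starts at the vacant state, so `cross-preserved` would carry its crossing
    -- edge back to `K`.
    good-uncrossed : ∀ b {K} → ¬ Cross b d K → Good b d k K
    good-uncrossed b nc c≡0 w cr = nc (cross-preserved free b c≡0 (walk-reverse w) cr)

    exact-left : ∀ {K} → Exact a (d + d) K → Exact a d K
    exact-left ex a<x x≤m = ex a<x (≤-trans x≤m (≤-trans (m≤m+n m d) (≤-reflexive e)))

    exact-right : ∀ {K} → Exact a (d + d) K → Exact m d K
    exact-right ex m<x x≤c = ex (≤-<-trans (m≤m+n a d) m<x) (≤-trans x≤c (≤-reflexive e))

    -- Collapsing more vertices keeps every step of the path; one collapsed step is appended because
    -- the right ends differ.
    threat-left : ∀ {K} → Threat a (d + d) K → Threat a d K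
    threat-left {K} (i , p) = i , Star.map f p ◅◅ (inj₂ (inj₁ (s≤s m≤c , ≤-refl)) ◅ ε)
      where
      m≤c : m ≤ a + (d + d)
      m≤c = ≤-trans (m≤m+n m d) (≤-reflexive e)
      f : ∀ {x y} → Collapsed a (d + d) (Seen i (R K)) x y → Collapsed a d (Seen i (R K)) x y
      f (inj₁ p) = inj₁ p
      f (inj₂ (inj₁ (p , q))) = inj₂ (inj₁ (≤-<-trans m≤c p , ≤-<-trans m≤c q))
      f (inj₂ (inj₂ s)) = inj₂ (inj₂ s)

    threat-right : ∀ {K} → Threat a (d + d) K → Threat m d K
    threat-right {K} (i , p) = i , inj₁ (≤-refl , m≤m+n a d) ◅ subst (λ c → Star (Collapsed m d (Seen i (R K))) a (suc c)) (sym e) (Star.map f p)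
      where
      f : ∀ {x y} → Collapsed a (d + d) (Seen i (R K)) x y → Collapsed m d (Seen i (R K)) x y
      f (inj₁ (p , q)) = inj₁ (≤-trans p (m≤m+n a d) , ≤-trans q (m≤m+n a d))
      f (inj₂ (inj₁ (p , q))) = inj₂ (inj₁ (≤-<-trans (≤-reflexive e) p , ≤-<-trans (≤-reflexive e) q))
      f (inj₂ (inj₂ s)) = inj₂ (inj₂ s)

    split : ∀ K → ∣ K ∣[ a , d + d ] ≡ ∣ K ∣[ a , d ] + ∣ K ∣[ m , d ]
    split K = count-+ (S K) a d d

    record Invariant (K : State) : Set₁ where
      field
        good-left  : Good a d k K
        good-right : Good m d k K
        anchor     : Anchored a d k K ⊎ Anchored m d k K

    open Invariant

    -- An edge over one half has an end in the other half, where nothing is mentioned, or crosses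
    -- the whole interval.
    invariant-start : ∀ {K} → ∣ K ∣[ a , d + d ] ≡ 0 → ¬ Cross a (d + d) K → Invariant K
    invariant-start {K} c≡0 nc = record
      { good-left  = good-uncrossed a ncˡ
      ; good-right = good-uncrossed m ncʳ
      ; anchor     = inj₁ (anchored (m+n≡0⇒m≡0 _ (trans (sym (split K)) c≡0)) ncˡ ε)
      }
      where
      ncˡ : ¬ Cross a d K
      ncˡ (x , y , x≤a , m<y , r) with y ≤? a + (d + d)
      ... | yes y≤c = count≡0⇒∉ (S K) a (d + d) c≡0 (≤-<-trans (m≤m+n a d) m<y) y≤c (tgt∈ K r)
      ... | no y≰c  = nc (x , y , x≤a , ≰⇒> y≰c , r)
      ncʳ : ¬ Cross m d K
      ncʳ (x , y , x≤m , c<y , r) with a <? x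
      ... | yes a<x = count≡0⇒∉ (S K) a (d + d) c≡0 a<x
                        (≤-trans x≤m (≤-trans (m≤m+n m d) (≤-reflexive e))) (src∈ K r)
      ... | no a≮x  = nc (x , y , ≮⇒≥ a≮x , ≤-<-trans (≤-reflexive (sym e)) c<y , r)

    module _ {K K′} (inv : Invariant K) (s : Small a (d + d) (suc k) K)
             (s′ : Small a (d + d) (suc k) K′) (st : Step K K′) where

      private
        total : ∀ {K} → Small a (d + d) (suc k) K → ∣ K ∣[ a , d ] + ∣ K ∣[ m , d ] ≤ suc k
        total {K} (small _ c≤) = ≤-trans (≤-reflexive (sym (split K))) c≤

        exˡ : ∀ {K} → Small a (d + d) (suc k) K → Exact a d K
        exˡ {K} s = exact-left {K} (Small.exact s)

        exʳ : ∀ {K} → Small a (d + d) (suc k) K → Exact m d K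
        exʳ {K} s = exact-right {K} (Small.exact s)

      good-left-step : Good a d k K′
      good-left-step with ∣ K ∣[ a , d ] ≤? k | ∣ K′ ∣[ a , d ] ≤? k
      ... | _       | no ≰k   = good-vacuous (≰⇒> ≰k)
      ... | yes ≤k  | yes ≤k′ = λ c≡0 w →
        good-left inv c≡0 ((small (exˡ s) ≤k , small (exˡ s′) ≤k′ , st) ◅ w)
      -- The full left half exhausts the budget `suc k`. A crossing edge in `K′` would keep all
      -- those vertices and add `suc m` from the right half.
      ... | no ≰k   | yes ≤k′ = good-uncrossed a λ cr →
        let 1+m∈ , kept = left-kept 0<d st (count≡0⇒∉ (S K) m d vacant) (good-right inv vacant ε) (exˡ s) cr
        in <⇒≱ (+-mono-≤ (≤-trans (≰⇒> ≰k) (count-mono a d kept))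
                         (∈⇒0<count (S K′) m d ≤-refl (≤-trans (≤-reflexive (+-comm 1 m)) (+-monoʳ-≤ m 0<d)) 1+m∈))
               (≤-trans (total s′) (≤-reflexive (+-comm 1 k)))
        where
        vacant : ∣ K ∣[ m , d ] ≡ 0
        vacant = n≤0⇒n≡0 (+-cancelˡ-≤ (suc k) _ _ (≤-trans (+-monoˡ-≤ _ (≰⇒> ≰k)) (≤-trans (total s) (m≤m+n _ _))))

      good-right-step : Good m d k K′
      good-right-step with ∣ K ∣[ m , d ] ≤? k | ∣ K′ ∣[ m , d ] ≤? k
      ... | _       | no ≰k   = good-vacuous (≰⇒> ≰k)
      ... | yes ≤k  | yes ≤k′ = λ c≡0 w →
        good-right inv c≡0 ((small (exʳ s) ≤k , small (exʳ s′) ≤k′ , st) ◅ w)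
      ... | no ≰k   | yes ≤k′ = good-uncrossed m λ cr →
        let m∈ , kept = right-kept 0<d st (count≡0⇒∉ (S K) a d vacant) (good-left inv vacant ε) (exʳ s) cr
        in <⇒≱ (+-mono-≤ (∈⇒0<count (S K′) a d (m<m+n a 0<d) ≤-refl m∈)
                         (≤-trans (≰⇒> ≰k) (count-mono m d kept)))
               (total s′)
        where
        vacant : ∣ K ∣[ a , d ] ≡ 0
        vacant = n≤0⇒n≡0 (+-cancelʳ-≤ (suc k) _ _ (≤-trans (+-monoʳ-≤ _ (≰⇒> ≰k)) (total s)))

      -- If neither half is vacant afterwards, neither holds more than k vertices.
      anchor-step : Anchored a d k K′ ⊎ Anchored m d k K′
      anchor-step with ∣ K′ ∣[ a , d ] ≟ 0 | ∣ K′ ∣[ m , d ] ≟ 0 | anchor inv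
      -- A vacant half is its own origin: goodness along the empty walk makes it uncrossed.
      ... | yes ≡0 | _      | _ = inj₁ (anchored ≡0 (good-left-step ≡0 ε) ε)
      ... | no _   | yes ≡0 | _ = inj₂ (anchored ≡0 (good-right-step ≡0 ε) ε)
      ... | no _   | no ≢0  | inj₁ (anchored c≡0 nc w) = inj₁ (anchored c≡0 nc
        (w ◅◅ ((small (exˡ s) (walk-count w (≤-trans (≤-reflexive c≡0) z≤n)) , small (exˡ s′) ≤k , st) ◅ ε)))
        where
        ≤k : ∣ K′ ∣[ a , d ] ≤ k
        ≤k = s≤s⁻¹ (≤-trans (m<m+n _ (n≢0⇒n>0 ≢0)) (total s′))
      ... | no ≢0  | no _   | inj₂ (anchored c≡0 nc w) = inj₂ (anchored c≡0 nc
        (w ◅◅ ((small (exʳ s) (walk-count w (≤-trans (≤-reflexive c≡0) z≤n)) , small (exʳ s′) ≤k , st) ◅ ε)))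
        where
        ≤k : ∣ K′ ∣[ m , d ] ≤ k
        ≤k = s≤s⁻¹ (≤-trans (m<n+m _ (n≢0⇒n>0 ≢0)) (total s′))

    invariant-walk : ∀ {K K′} → Invariant K → Walk a (d + d) (suc k) K K′ → Invariant K′
    invariant-walk inv ε = inv
    invariant-walk inv ((s , s′ , st) ◅ w) = invariant-walk (record
      { good-left  = good-left-step inv s s′ st
      ; good-right = good-right-step inv s s′ st
      ; anchor     = anchor-step inv s s′ st
      }) w

    no-threat : ∀ {K} → Invariant K → ¬ Threat a (d + d) K
    no-threat {K} inv th with anchor inv
    ... | inj₁ (anchored c≡0 nc w) = free a c≡0 nc w (threat-left {K} th)
    ... | inj₂ (anchored c≡0 nc w) = free m c≡0 nc w (threat-right {K} th)

  -- Powers of two, doubled by a sum so that an interval of `pow (suc k)` vertices unfolds into its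
  -- two halves.
  pow : ℕ → ℕ
  pow zero    = 1
  pow (suc k) = pow k + pow k

  0<pow : ∀ k → 0 < pow k
  0<pow zero    = s≤s z≤n
  0<pow (suc k) = ≤-trans (0<pow k) (m≤m+n _ _)

  threat-free : ∀ k → ThreatFree (pow k) k
  threat-free zero    = threat-free-base
  threat-free (suc k) a c≡0 nc w =
    no-threat (threat-free k) (0<pow k) a
      (invariant-walk (threat-free k) (0<pow k) a (invariant-start (threat-free k) (0<pow k) a c≡0 nc) w)

-- Logarithms and natural-number inequalities

module Arithmetic where

  open import Data.Nat.Base
  open import Data.Nat.DivMod using (_/_; _%_; m≡m%n+[m/n]*n; m%n<n; m≥n⇒m/n>0)
  open import Data.Nat.Logarithm using (⌈log₂_⌉; ⌈log₂⌉-mono-≤; ⌈log₂2^n⌉≡n; ⌈log₂⌈n/2⌉⌉≡⌈log₂n⌉∸1)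
  open import Data.Nat.Properties
  open import Data.Nat.Tactic.RingSolver using (solve-∀)
  open import Data.Product.Base using (∃-syntax; _×_; _,_)
  open import Data.Sum.Base using (inj₁; inj₂)
  open import Relation.Binary.PropositionalEquality
  open import Relation.Nullary.Decidable.Core using (yes; no)
  open import Relation.Nullary.Negation.Core using (¬_)
  open LineGame using (pow; 0<pow)

  pow≡2^ : ∀ k → pow k ≡ 2 ^ k
  pow≡2^ zero    = refl
  pow≡2^ (suc k) rewrite pow≡2^ k = cong (2 ^ k +_) (sym (+-identityʳ (2 ^ k)))

  -- Halving `suc (pow k + pow k)` and rounding up gives `suc (pow k)`, which lowers the rounded
  -- logarithm by one.
  log-1+pow : ∀ k → k < ⌈log₂ suc (pow k) ⌉
  log-1+pow zero    = s≤s z≤n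
  log-1+pow (suc k) = ≤-trans (s≤s (log-1+pow k)) (≤-trans (s≤s (≤-reflexive half)) (≤-reflexive (m+[n∸m]≡n 0<log)))
    where
    half : ⌈log₂ suc (pow k) ⌉ ≡ ⌈log₂ suc (pow k + pow k) ⌉ ∸ 1
    half = trans (cong (λ m → ⌈log₂ suc m ⌉) (n≡⌊n+n/2⌋ (pow k))) (⌈log₂⌈n/2⌉⌉≡⌈log₂n⌉∸1 (suc (pow k + pow k)))
    0<log : 1 ≤ ⌈log₂ suc (pow k + pow k) ⌉
    0<log = ≤-trans (log-1+pow 0) (⌈log₂⌉-mono-≤ (s≤s (≤-trans (0<pow k) (m≤m+n (pow k) (pow k)))))

  ≤pow-log : ∀ l → l ≤ pow ⌈log₂ l ⌉
  ≤pow-log l = ≮⇒≥ λ pow<l → <-irrefl refl (≤-trans (log-1+pow ⌈log₂ l ⌉) (⌈log₂⌉-mono-≤ pow<l))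

  pow<⇐<log : ∀ {k l} → k < ⌈log₂ l ⌉ → pow k < l
  pow<⇐<log {k} k<log = ≰⇒> λ l≤pow → <⇒≱ k<log (≤-trans (⌈log₂⌉-mono-≤ l≤pow)
    (≤-reflexive (trans (cong ⌈log₂_⌉ (pow≡2^ k)) (⌈log₂2^n⌉≡n k))))

  0<log₂ : ∀ {l} → 2 ≤ l → 0 < ⌈log₂ l ⌉
  0<log₂ 2≤l = ≤-trans (log-1+pow 0) (⌈log₂⌉-mono-≤ 2≤l)

  ^-distribʳ-* : ∀ a b n → (a * b) ^ n ≡ a ^ n * b ^ n
  ^-distribʳ-* a b zero    = refl
  ^-distribʳ-* a b (suc n) = trans (cong (a * b *_) (^-distribʳ-* a b n)) (interchange a b (a ^ n) (b ^ n))
    where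
    interchange : ∀ a b x y → a * b * (x * y) ≡ a * x * (b * y)
    interchange = solve-∀

  -- The remainder is below `L`, and the positive quotient allows `L` to be absorbed into a second
  -- copy of `n / L * L`. This is the origin of the 2 in 2(l - 1).
  n≤2L[n/L] : ∀ n L .{{_ : NonZero L}} → L ≤ n → n ≤ 2 * L * (n / L)
  n≤2L[n/L] n L L≤n = begin
    n                         ≡⟨ m≡m%n+[m/n]*n n L ⟩
    n % L + n / L * L         ≤⟨ +-monoˡ-≤ _ (<⇒≤ (m%n<n n L)) ⟩
    L + n / L * L             ≤⟨ +-monoˡ-≤ _ (≤-trans (≤-reflexive (sym (*-identityˡ L))) (*-monoˡ-≤ L (m≥n⇒m/n>0 L≤n))) ⟩
    n / L * L + n / L * L     ≡⟨ double (n / L) L ⟩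
    2 * L * (n / L)           ∎
    where
    open ≤-Reasoning
    double : ∀ q L → q * L + q * L ≡ 2 * L * q
    double = solve-∀

  -- `r` is the integer part of √(n/2); it grows by at most one when `n` does.
  half-root : ∀ n → ∃[ r ] (2 * (r * r) ≤ n × n < 2 * (suc r * suc r))
  half-root zero = 0 , z≤n , s≤s z≤n
  half-root (suc n) with half-root n
  ... | r , ≤n , n< with suc n <? 2 * (suc r * suc r)
  ...   | yes 1+n< = r , m≤n⇒m≤1+n ≤n , 1+n<
  ...   | no 1+n≮  = suc r , ≮⇒≥ 1+n≮ , ≤-<-trans n< (*-monoʳ-< 2 (*-mono-< (n<1+n (suc r)) (n<1+n (suc r))))

  -- Squares of c ≥ (n / 2r)^k combined with (2r)² ≤ 2n.
  fourth-power-bound : ∀ c n r k .{{_ : NonZero n}} → 2 * (r * r) ≤ n → n ^ k ≤ c * (2 * r) ^ k →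
    n ^ (2 * k) ≤ c ^ 4 * 4 ^ k
  fourth-power-bound c n r k 2r²≤n bound = begin
    n ^ (2 * k)               ≡⟨ cong (n ^_) (*-comm 2 k) ⟩
    n ^ (k * 2)               ≡⟨ ^-*-assoc n k 2 ⟨
    (n ^ k) ^ 2               ≤⟨ ^-monoˡ-≤ 2 (*-cancelʳ-≤ (n ^ k) (c ^ 2 * 2 ^ k) (n ^ k) {{m^n≢0 n k}} squared) ⟩
    (c ^ 2 * 2 ^ k) ^ 2       ≡⟨ ^-distribʳ-* (c ^ 2) (2 ^ k) 2 ⟩
    (c ^ 2) ^ 2 * (2 ^ k) ^ 2 ≡⟨ cong₂ _*_ (^-*-assoc c 2 2) (trans (^-*-assoc 2 k 2) (trans (cong (2 ^_) (*-comm k 2)) (sym (^-*-assoc 2 2 k)))) ⟩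
    c ^ 4 * 4 ^ k             ∎
    where
    open ≤-Reasoning
    square : ∀ a b → (a * b) * (a * b) ≡ a * (a * 1) * (b * b)
    square = solve-∀
    regroup : ∀ r → 2 * r * (2 * r) ≡ 2 * (2 * (r * r))
    regroup = solve-∀
    squared : n ^ k * n ^ k ≤ c ^ 2 * 2 ^ k * n ^ k
    squared = begin
      n ^ k * n ^ k                             ≤⟨ *-mono-≤ bound bound ⟩
      (c * (2 * r) ^ k) * (c * (2 * r) ^ k)     ≡⟨ square c ((2 * r) ^ k) ⟩
      c ^ 2 * ((2 * r) ^ k * (2 * r) ^ k)       ≡⟨ cong (c ^ 2 *_) (^-distribʳ-* (2 * r) (2 * r) k) ⟨
      c ^ 2 * (2 * r * (2 * r)) ^ k             ≡⟨ cong (λ x → c ^ 2 * x ^ k) (regroup r) ⟩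
      c ^ 2 * (2 * (2 * (r * r))) ^ k           ≤⟨ *-monoʳ-≤ (c ^ 2) (^-monoˡ-≤ k (*-monoʳ-≤ 2 2r²≤n)) ⟩
      c ^ 2 * (2 * n) ^ k                       ≡⟨ cong (c ^ 2 *_) (^-distribʳ-* 2 n k) ⟩
      c ^ 2 * (2 ^ k * n ^ k)                   ≡⟨ *-assoc (c ^ 2) (2 ^ k) (n ^ k) ⟨
      c ^ 2 * 2 ^ k * n ^ k                     ∎

  module _ {c n k : ℕ} (2≤n : 2 ≤ n) (0<c : 0 < c)
           (bound : n ^ (2 * k) ≤ c ^ 4 * 4 ^ k) (n<2·4^k : n < 2 * 4 ^ k) where

    private
      instance
        n-nonZero : NonZero n
        n-nonZero = >-nonZero (≤-trans (s≤s z≤n) 2≤n)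
        c-nonZero : NonZero c
        c-nonZero = >-nonZero 0<c

    -- c ≥ n^(a/4 − 1/2) for every a = α/β below lg n.
    power-bound : ∀ α β .{{_ : NonZero β}} → 2 ^ α < n ^ β → n ^ α ≤ c ^ (4 * β) * n ^ (2 * β)
    power-bound α β 2^α<n^β with ≤-total α β
    ... | inj₁ α≤β = ≤-trans (^-monoʳ-≤ n (≤-trans α≤β (m≤n*m β 2)))
                       (m≤n*m (n ^ (2 * β)) (c ^ (4 * β)) {{m^n≢0 c (4 * β)}})
    ... | inj₂ β≤α = begin
      n ^ α                              ≡⟨ cong (n ^_) (sym γ+β) ⟩
      n ^ (γ + β)                        ≡⟨ ^-distribˡ-+-* n γ β ⟩
      n ^ γ * n ^ β                      ≤⟨ *-monoˡ-≤ (n ^ β) step ⟩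
      c ^ (4 * β) * 2 ^ γ * n ^ β        ≤⟨ *-monoˡ-≤ (n ^ β) (*-monoʳ-≤ (c ^ (4 * β)) 2^γ≤n^β) ⟩
      c ^ (4 * β) * n ^ β * n ^ β        ≡⟨ *-assoc (c ^ (4 * β)) (n ^ β) (n ^ β) ⟩
      c ^ (4 * β) * (n ^ β * n ^ β)      ≡⟨ cong (c ^ (4 * β) *_) (^-distribˡ-+-* n β β) ⟨
      c ^ (4 * β) * n ^ (β + β)          ≡⟨ cong (λ x → c ^ (4 * β) * n ^ (β + x)) (+-identityʳ β) ⟨
      c ^ (4 * β) * n ^ (2 * β)          ∎
      where
      open ≤-Reasoning
      -- The bound gives (n/2)^γ ≤ c^(4β) as long as γ ≤ 2kβ, whereas `n < 2 · 4 ^ k` only gives α <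
      -- (2k + 1)β: subtracting `β` brings the exponent into range. This costs one factor n^β, and
      -- 2^γ ≤ n^β costs the other.
      γ : ℕ
      γ = α ∸ β
      γ+β : γ + β ≡ α
      γ+β = m∸n+n≡m β≤α
      2^γ≤n^β : 2 ^ γ ≤ n ^ β
      2^γ≤n^β = ≤-trans (^-monoʳ-≤ 2 (m∸n≤m α β)) (<⇒≤ 2^α<n^β)
      exponent : ∀ k → 2 * 4 ^ k ≡ 2 ^ suc (2 * k)
      exponent k = cong (2 *_) (^-*-assoc 2 2 k)
      α< : α < suc (2 * k) * β
      α< = ≰⇒> λ ≤α → <⇒≱ 2^α<n^β (begin
        n ^ β                   ≤⟨ ^-monoˡ-≤ β (≤-trans (<⇒≤ n<2·4^k) (≤-reflexive (exponent k))) ⟩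
        (2 ^ suc (2 * k)) ^ β   ≡⟨ ^-*-assoc 2 (suc (2 * k)) β ⟩
        2 ^ (suc (2 * k) * β)   ≤⟨ ^-monoʳ-≤ 2 ≤α ⟩
        2 ^ α                   ∎)
      γ≤ : γ ≤ 2 * k * β
      γ≤ = ≤-trans (∸-monoˡ-≤ β (<⇒≤ α<)) (≤-reflexive (m+n∸m≡n β (2 * k * β)))
      -- Fills `γ` up to the exponent of `bound`; since `2 ≤ n`, the surplus n^δ may be weakened to
      -- 2^δ and cancelled.
      δ : ℕ
      δ = 2 * k * β ∸ γ
      γ+δ : γ + δ ≡ 2 * k * β
      γ+δ = m+[n∸m]≡n γ≤
      step : n ^ γ ≤ c ^ (4 * β) * 2 ^ γ
      step = *-cancelʳ-≤ _ _ (2 ^ δ) {{m^n≢0 2 δ}} (begin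
        n ^ γ * 2 ^ δ                  ≤⟨ *-monoʳ-≤ (n ^ γ) (^-monoˡ-≤ δ 2≤n) ⟩
        n ^ γ * n ^ δ                  ≡⟨ ^-distribˡ-+-* n γ δ ⟨
        n ^ (γ + δ)                    ≡⟨ cong (n ^_) γ+δ ⟩
        n ^ (2 * k * β)                ≡⟨ ^-*-assoc n (2 * k) β ⟨
        (n ^ (2 * k)) ^ β              ≤⟨ ^-monoˡ-≤ β bound ⟩
        (c ^ 4 * 4 ^ k) ^ β            ≡⟨ ^-distribʳ-* (c ^ 4) (4 ^ k) β ⟩
        (c ^ 4) ^ β * (4 ^ k) ^ β      ≡⟨ cong₂ _*_ (^-*-assoc c 4 β) (trans (cong (_^ β) (^-*-assoc 2 2 k)) (^-*-assoc 2 (2 * k) β)) ⟩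
        c ^ (4 * β) * 2 ^ (2 * k * β)  ≡⟨ cong (λ x → c ^ (4 * β) * 2 ^ x) γ+δ ⟨
        c ^ (4 * β) * 2 ^ (γ + δ)      ≡⟨ cong (c ^ (4 * β) *_) (^-distribˡ-+-* 2 γ δ) ⟩
        c ^ (4 * β) * (2 ^ γ * 2 ^ δ)  ≡⟨ *-assoc (c ^ (4 * β)) (2 ^ γ) (2 ^ δ) ⟨
        c ^ (4 * β) * 2 ^ γ * 2 ^ δ    ∎)

    -- For p = π/ρ and a = α/β the inequality between exponents is p ≤ a/4 - 1/2 with denominators
    -- cleared.
    not-below : ∀ α β π ρ .{{_ : NonZero β}} → 2 ^ α < n ^ β →
      4 * π * β + 2 * β * ρ ≤ α * ρ → ¬ (c ^ ρ < n ^ π)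
    not-below α β π ρ 2^α<n^β exponents c^ρ<n^π = <⇒≱
      (^-monoˡ-< (4 * β) {{m*n≢0 4 β}} c^ρ<n^π)
      (*-cancelʳ-≤ _ _ (n ^ (2 * β * ρ)) {{m^n≢0 n (2 * β * ρ)}} (begin
        (n ^ π) ^ (4 * β) * n ^ (2 * β * ρ)    ≡⟨ cong (_* n ^ (2 * β * ρ)) (trans (^-*-assoc n π (4 * β)) (cong (n ^_) (swap π β))) ⟩
        n ^ (4 * π * β) * n ^ (2 * β * ρ)      ≡⟨ ^-distribˡ-+-* n (4 * π * β) (2 * β * ρ) ⟨
        n ^ (4 * π * β + 2 * β * ρ)            ≤⟨ ^-monoʳ-≤ n exponents ⟩
        n ^ (α * ρ)                            ≡⟨ ^-*-assoc n α ρ ⟨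
        (n ^ α) ^ ρ                            ≤⟨ ^-monoˡ-≤ ρ (power-bound α β 2^α<n^β) ⟩
        (c ^ (4 * β) * n ^ (2 * β)) ^ ρ        ≡⟨ ^-distribʳ-* (c ^ (4 * β)) (n ^ (2 * β)) ρ ⟩
        (c ^ (4 * β)) ^ ρ * (n ^ (2 * β)) ^ ρ  ≡⟨ cong₂ _*_ (trans (^-*-assoc c (4 * β) ρ) (trans (cong (c ^_) (*-comm (4 * β) ρ)) (sym (^-*-assoc c ρ (4 * β))))) (^-*-assoc n (2 * β) ρ) ⟩
        (c ^ ρ) ^ (4 * β) * n ^ (2 * β * ρ)    ∎))
      where
      open ≤-Reasoning
      swap : ∀ π β → π * (4 * β) ≡ 4 * π * β
      swap = solve-∀

open import Defs
open import Data.Bool.Base using (Bool; true; false; T; _∨_; not)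
import Data.Bool.Properties as Bool
open import Data.Bool.Properties using (T?; T-∨)
open import Data.Empty using (⊥; ⊥-elim; ⊥-elim-irr)
open import Data.Fin.Base using (Fin; zero; suc; toℕ; fromℕ; fromℕ<; inject₁; inject≤; combine; funToFin; finToFun)
open import Data.Fin.Properties using (_≟_; any?; all?; suc-injective; toℕ<n; toℕ-fromℕ<; toℕ-inject₁; inject≤-injective; combine-injective; injective⇒≤; finToFun-funToFin; funToFin-finToFin)
open import Data.Fin.Subset using (Subset; ⁅_⁆; _∪_; ∁; ∣_∣)
import Data.Fin.Subset as Subset
import Data.Fin.Subset.Properties as Subset
open import Data.Integer.Base as ℤ using (+_; -[1+_])
import Data.Integer.Properties as ℤ
import Data.Integer.Tactic.RingSolver as ℤ-Solver
open import Data.List.Base as List using (List; []; _∷_; length; allFin; cartesianProductWith; cartesianProduct; concatMap)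
open import Data.List.Membership.Propositional using (_∈_; lose; find)
open import Data.List.Membership.Propositional.Properties using (∈-allFin; ∈-filter⁺; ∈-filter⁻; ∈-cartesianProduct⁺)
open import Data.List.Relation.Unary.All as All using (All; []; _∷_)
open import Data.List.Relation.Unary.Any as Any using (Any; here; there)
import Data.List.Relation.Unary.Any.Properties as Any
open import Data.Nat.Base as ℕ using (ℕ; zero; suc; z≤n; s≤s; NonZero; _+_; _≤_; _<_)
open import Data.Nat.Coprimality as Coprime using (Coprime)
open import Data.Nat.DivMod using (m/n*n≤m; m≥n⇒m/n>0)
open import Data.Nat.Logarithm using (⌈log₂_⌉)
import Data.Nat.Properties as ℕ
open import Data.Product.Base using (Σ-syntax; ∃-syntax; _×_; _,_; proj₁; proj₂; uncurry)
open import Data.Rational.Base as ℚ using (ℚ; mkℚ; 0ℚ; 1ℚ; ½; -_; _/_; toℚᵘ)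
import Data.Rational.Properties as ℚ
open import Data.Rational.Unnormalised.Base as ℚᵘ using (mkℚᵘ)
import Data.Rational.Unnormalised.Properties as ℚᵘ
open import Data.Sum.Base as Sum using (_⊎_; inj₁; inj₂)
open import Data.Vec.Base using (_∷_; here; there)
open import Function.Base using (_∘_)
open import Function.Bundles using (_⇔_; mk⇔; Equivalence)
open import Level using (0ℓ)
open import Relation.Binary.Construct.Closure.ReflexiveTransitive as Star using (Star; ε; _◅_; _◅◅_; reverse)
open import Relation.Binary.Core using (Rel)
open import Relation.Binary.Definitions using (Symmetric; Decidable)
open import Relation.Binary.PropositionalEquality
open import Relation.Nullary.Decidable.Core using (Dec; yes; no; map′; _×-dec_; _⊎-dec_; _→-dec_; ¬?; ⌊_⌋; toWitness; fromWitness)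
open import Relation.Nullary.Negation.Core using (¬_)
open import Relation.Unary using (Pred; _⊆_)

-- Decidability by search through finite types

module FiniteSearch where

  -- Completeness is up to `≈` because functions, and with them edge sets, are listed up to
  -- pointwise equality. Predicates searched over must respect it.
  record Enumeration {A : Set} (_≈_ : Rel A 0ℓ) : Set where
    field
      elements : List A
      complete : ∀ x → Any (x ≈_) elements
      ≈-sym    : Symmetric _≈_

  open Enumeration

  module _ {A : Set} {_≈_ : Rel A 0ℓ} (enum : Enumeration _≈_) {P : Pred A 0ℓ}
           (resp : ∀ {x y} → x ≈ y → P x → P y) (P? : ∀ x → Dec (P x)) where

    ∃-dec : Dec (∃[ x ] P x)
    ∃-dec = map′ Any.satisfied (λ (x , px) → Any.map (λ x≈y → resp x≈y px) (complete enum x))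
      (Any.any? P? (elements enum))

    ∀-dec : Dec (∀ x → P x)
    ∀-dec = map′ (λ pxs x → All.lookupWith (λ py x≈y → resp (≈-sym enum x≈y) py) pxs (complete enum x))
      (λ p → All.universal p (elements enum)) (All.all? P? (elements enum))

  bools : Enumeration {Bool} _≡_
  bools = record
    { elements = true ∷ false ∷ []
    ; complete = λ { true → here refl ; false → there (here refl) }
    ; ≈-sym    = sym
    }

  fins : ∀ n → Enumeration {Fin n} _≡_
  fins n = record { elements = allFin n ; complete = ∈-allFin ; ≈-sym = sym }

  Pointwise : ∀ {A B : Set} → Rel B 0ℓ → Rel (A → B) 0ℓ
  Pointwise _≈_ f g = ∀ x → f x ≈ g x

  functions : ∀ {A : Set} {_≈_ : Rel A 0ℓ} → Enumeration _≈_ →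
              ∀ n → Enumeration {Fin n → A} (Pointwise _≈_)
  functions {A} {_≈_} enum n = record
    { elements = go n ; complete = done n ; ≈-sym = λ f≈g i → ≈-sym enum (f≈g i) }
    where
    cons : ∀ {n} → A → (Fin n → A) → Fin (suc n) → A
    cons x f zero    = x
    cons x f (suc i) = f i
    go : ∀ n → List (Fin n → A)
    go zero    = (λ ()) ∷ []
    go (suc n) = cartesianProductWith cons (elements enum) (go n)
    done : ∀ n (f : Fin n → A) → Any (Pointwise _≈_ f) (go n)
    done zero    f = here λ ()
    done (suc n) f = Any.cartesianProductWith⁺ cons
      (λ { p q zero → p ; p q (suc i) → q i }) (complete enum (f zero)) (done n (f ∘ suc))

  Edge-≡ : ∀ {N} {e f : Edge N} → src e ≡ src f → tgt e ≡ tgt f → e ≡ f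
  Edge-≡ refl refl = refl

  _≟ₑ_ : ∀ {N} (e f : Edge N) → Dec (e ≡ f)
  e ≟ₑ f = map′ (uncurry Edge-≡) (λ { refl → refl , refl }) (src e ≟ src f ×-dec tgt e ≟ tgt f)

  src≢tgt′ : ∀ {N} (e : Edge N) → src e ≢ tgt e
  src≢tgt′ (edge u v u≢v) u≡v = ⊥-elim-irr (u≢v u≡v)

  edgesFrom : ∀ {N} → Fin N → Fin N → List (Edge N)
  edgesFrom u v with u ≟ v
  ... | yes _  = []
  ... | no u≢v = edge u v u≢v ∷ []

  ∈-edgesFrom : ∀ {N} (e : Edge N) → e ∈ edgesFrom (src e) (tgt e)
  ∈-edgesFrom e with src e ≟ tgt e
  ... | yes u≡v = ⊥-elim (src≢tgt′ e u≡v)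
  ... | no u≢v  = here refl

  allEdges : ∀ N → Enumeration {Edge N} _≡_
  allEdges N = record
    { elements = concatMap (uncurry edgesFrom) (cartesianProduct (allFin N) (allFin N))
    ; complete = λ e → Any.concatMap⁺ (uncurry edgesFrom)
        (lose (∈-cartesianProduct⁺ (∈-allFin (src e)) (∈-allFin (tgt e))) (∈-edgesFrom e))
    ; ≈-sym = sym
    }

  ∃ₑ-dec : ∀ {N} {P : Pred (Edge N) 0ℓ} → (∀ e → Dec (P e)) → Dec (∃[ e ] P e)
  ∃ₑ-dec {N} {P} = ∃-dec (allEdges N) (subst P)

  ∀ₑ-dec : ∀ {N} {P : Pred (Edge N) 0ℓ} → (∀ e → Dec (P e)) → Dec (∀ e → P e)
  ∀ₑ-dec {N} {P} = ∀-dec (allEdges N) (subst P)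

  -- Edge sets are listed as Boolean matrices; the diagonal holds a default value that no edge
  -- reads.
  edgeSets : ∀ N → Enumeration {EdgeSet N} (Pointwise _≡_)
  edgeSets N = record
    { elements = List.map toSet (elements matrices)
    ; complete = λ K → Any.map⁺ (Any.map (λ eq e → trans (sym (fromSet-edge K e)) (eq (src e) (tgt e)))
                                         (complete matrices (fromSet K)))
    ; ≈-sym = λ K≗K′ e → sym (K≗K′ e)
    }
    where
    matrices : Enumeration {Fin N → Fin N → Bool} (Pointwise (Pointwise _≡_))
    matrices = functions (functions bools N) N
    toSet : (Fin N → Fin N → Bool) → EdgeSet N
    toSet M e = M (src e) (tgt e)
    fromSet : EdgeSet N → Fin N → Fin N → Bool
    fromSet K u v with u ≟ v
    ... | yes _  = false
    ... | no u≢v = K (edge u v u≢v)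
    fromSet-edge : ∀ K e → fromSet K (src e) (tgt e) ≡ K e
    fromSet-edge K e with src e ≟ tgt e
    ... | yes u≡v = ⊥-elim (src≢tgt′ e u≡v)
    ... | no _    = refl

  -- Floyd–Warshall: Via zs relates x and y joined by an R-path whose
  -- intermediate vertices lie in zs.
  module _ {A : Set} {_≈_ R : Rel A 0ℓ} (enum : Enumeration _≈_)
           (R-refl : ∀ {x} → R x x)
           (respˡ : ∀ {x x′ y} → x ≈ x′ → R x y → R x′ y)
           (respʳ : ∀ {x y y′} → y ≈ y′ → R x y → R x y′)
           (R? : Decidable R) where

    private
      Via : List A → Rel A 0ℓ
      Via []       x y = R x y
      Via (z ∷ zs) x y = Via zs x y ⊎ (Via zs x z × Via zs z y)

      Via? : ∀ zs → Decidable (Via zs)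
      Via? []       x y = R? x y
      Via? (z ∷ zs) x y = Via? zs x y ⊎-dec (Via? zs x z ×-dec Via? zs z y)

      Via-respˡ : ∀ zs {x x′ y} → x ≈ x′ → Via zs x y → Via zs x′ y
      Via-respˡ []       x≈ p              = respˡ x≈ p
      Via-respˡ (z ∷ zs) x≈ (inj₁ p)       = inj₁ (Via-respˡ zs x≈ p)
      Via-respˡ (z ∷ zs) x≈ (inj₂ (p , q)) = inj₂ (Via-respˡ zs x≈ p , q)

      R⇒Via : ∀ zs {x y} → R x y → Via zs x y
      R⇒Via []       r = r
      R⇒Via (z ∷ zs) r = inj₁ (R⇒Via zs r)

      Via⇒Star : ∀ zs {x y} → Via zs x y → Star R x y
      Via⇒Star []       r              = r ◅ ε
      Via⇒Star (z ∷ zs) (inj₁ p)       = Via⇒Star zs p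
      Via⇒Star (z ∷ zs) (inj₂ (p , q)) = Via⇒Star zs p ◅◅ Via⇒Star zs q

      -- A path to the newest point is cut at its first visit there, a path from it at its last.
      -- Further down, two passages through the outer point are short-circuited into one.
      Via-trans : ∀ zs {x y z} → z ∈ zs → Via zs x z → Via zs z y → Via zs x y
      Via-trans (z ∷ zs) (here refl) p q = inj₂ (to p , from q)
        where
        to : ∀ {x} → Via (z ∷ zs) x z → Via zs x z
        to (inj₁ p)       = p
        to (inj₂ (p , _)) = p
        from : ∀ {y} → Via (z ∷ zs) z y → Via zs z y
        from (inj₁ q)       = q
        from (inj₂ (_ , q)) = q
      Via-trans (_ ∷ zs) (there i) (inj₁ p)       (inj₁ q)       = inj₁ (Via-trans zs i p q)
      Via-trans (_ ∷ zs) (there i) (inj₁ p)       (inj₂ (q , r)) = inj₂ (Via-trans zs i p q , r)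
      Via-trans (_ ∷ zs) (there i) (inj₂ (p , q)) (inj₁ r)       = inj₂ (p , Via-trans zs i q r)
      Via-trans (_ ∷ zs) (there i) (inj₂ (p , _)) (inj₂ (_ , r)) = inj₂ (p , r)

      Star⇒Via : ∀ {x y} → Star R x y → Via (elements enum) x y
      Star⇒Via ε = R⇒Via (elements enum) R-refl
      Star⇒Via (_◅_ {j = z} r rs) with find (complete enum z)
      ... | z′ , z′∈ , z≈z′ = Via-trans (elements enum) z′∈ (R⇒Via (elements enum) (respʳ z≈z′ r))
                                (Via-respˡ (elements enum) z≈z′ (Star⇒Via rs))

    Star-dec : Decidable (Star R)
    Star-dec x y = map′ (Via⇒Star (elements enum)) Star⇒Via (Via? (elements enum) x y)

  least : ∀ {P : Pred ℕ 0ℓ} → (∀ n → Dec (P n)) → ∀ {n} → P n →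
          ∃[ c ] (P c × (∀ m → P m → c ℕ.≤ m))
  least {P} P? {n} pn with P? zero
  ... | yes p0 = zero , p0 , λ _ _ → z≤n
  least {P} P? {zero}  pn | no ¬p0 = ⊥-elim (¬p0 pn)
  least {P} P? {suc n} pn | no ¬p0 with least (P? ∘ suc) pn
  ... | c , pc , min = suc c , pc , λ { zero p0 → ⊥-elim (¬p0 p0) ; (suc m) pm → s≤s (min m pm) }

-- Networks reduced to families of knowledge sets

module LinkNetworks where

  open FiniteSearch

  open Enumeration
  open SwitchingNetwork

  ⇔-dec : ∀ {A B : Set} → Dec A → Dec B → Dec (A ⇔ B)
  ⇔-dec A? B? = map′ (λ (f , g) → mk⇔ f g) (λ e → Equivalence.to e , Equivalence.from e)
    ((A? →-dec B?) ×-dec (B? →-dec A?))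

  infix 4 _≗ₑ_

  _≗ₑ_ : ∀ {N} → Rel (EdgeSet N) 0ℓ
  _≗ₑ_ = Pointwise _≡_

  ∋-resp : ∀ {N} {K K′ : EdgeSet N} {u v} → K ≗ₑ K′ → K ∋ u ⟶ v → K′ ∋ u ⟶ v
  ∋-resp K≗ (e , e∈ , eqs) = e , subst T (K≗ e) e∈ , eqs

  ∋-dec : ∀ {N} (K : EdgeSet N) u v → Dec (K ∋ u ⟶ v)
  ∋-dec K u v = ∃ₑ-dec λ e → T? (K e) ×-dec src e ≟ u ×-dec tgt e ≟ v

  module _ {N : ℕ} {f : Edge N} where

    addedOrRemoved-dec : ∀ K K′ → Dec (AddedOrRemoved f K K′)
    addedOrRemoved-dec K K′ =
      (∀ₑ-dec λ e → ⇔-dec (T? (K′ e)) (T? (K e) ⊎-dec e ≟ₑ f)) ⊎-dec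
      (∀ₑ-dec λ e → ⇔-dec (T? (K′ e)) (T? (K e) ×-dec ¬? (e ≟ₑ f)))

    addedOrRemoved-respˡ : ∀ {K L K′} → K ≗ₑ L → AddedOrRemoved f K K′ → AddedOrRemoved f L K′
    addedOrRemoved-respˡ {K′ = K′} K≗L (inj₁ a) =
      inj₁ λ e → subst (λ b → e ∈ₑ K′ ⇔ (T b ⊎ e ≡ f)) (K≗L e) (a e)
    addedOrRemoved-respˡ {K′ = K′} K≗L (inj₂ r) =
      inj₂ λ e → subst (λ b → e ∈ₑ K′ ⇔ (T b × e ≢ f)) (K≗L e) (r e)

    addedOrRemoved-respʳ : ∀ {K K′ L′} → K′ ≗ₑ L′ → AddedOrRemoved f K K′ → AddedOrRemoved f K L′
    addedOrRemoved-respʳ {K} K′≗L′ (inj₁ a) =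
      inj₁ λ e → subst (λ b → T b ⇔ (e ∈ₑ K ⊎ e ≡ f)) (K′≗L′ e) (a e)
    addedOrRemoved-respʳ {K} K′≗L′ (inj₂ r) =
      inj₂ λ e → subst (λ b → T b ⇔ (e ∈ₑ K × e ≢ f)) (K′≗L′ e) (r e)

    -- Adding a present edge or removing an absent one changes nothing, so idle moves exist; through
    -- them sequences of moves absorb pointwise equality.
    addedOrRemoved-refl : ∀ {K} → AddedOrRemoved f K K
    addedOrRemoved-refl {K} with T? (K f)
    ... | yes f∈ = inj₁ λ e → mk⇔ inj₁ λ { (inj₁ e∈) → e∈ ; (inj₂ refl) → f∈ }
    ... | no f∉  = inj₂ λ e → mk⇔ (λ e∈ → e∈ , λ { refl → f∉ e∈ }) proj₁

  module _ {N : ℕ} (s t : Fin N) where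

    -- Both directions are demanded because the edges of a network are undirected.
    Link : Edge N → Rel (KnowledgeSet N) 0ℓ
    Link e K K′ = Star (Move s t e) K K′ × Star (Move s t e) K′ K

    move-respˡ : ∀ {e K L K′} → K ≗ₑ L → Move s t e K K′ → Move s t e L K′
    move-respˡ K≗ (see a)              = see (addedOrRemoved-respˡ K≗ a)
    move-respˡ K≗ (transitive f p q a) = transitive f (∋-resp K≗ p) (∋-resp K≗ q) (addedOrRemoved-respˡ K≗ a)
    move-respˡ K≗ (goal f p ≢st a)     = goal f (∋-resp K≗ p) ≢st (addedOrRemoved-respˡ K≗ a)

    move-respʳ : ∀ {e K K′ L′} → K′ ≗ₑ L′ → Move s t e K K′ → Move s t e K L′
    move-respʳ K≗ (see a)              = see (addedOrRemoved-respʳ K≗ a)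
    move-respʳ K≗ (transitive f p q a) = transitive f p q (addedOrRemoved-respʳ K≗ a)
    move-respʳ K≗ (goal f p ≢st a)     = goal f p ≢st (addedOrRemoved-respʳ K≗ a)

    move-refl : ∀ {e K} → Move s t e K K
    move-refl = see addedOrRemoved-refl

    move-dec : ∀ e → Decidable (Move s t e)
    move-dec e K K′ = map′
      (λ { (inj₁ a)                                  → see a
         ; (inj₂ (inj₁ (f , (v , p , q) , a)))       → transitive f p q a
         ; (inj₂ (inj₂ (f , p , ≢st , a)))           → goal f p ≢st a })
      (λ { (see a)              → inj₁ a
         ; (transitive f p q a) → inj₂ (inj₁ (f , (_ , p , q) , a))
         ; (goal f p ≢st a)     → inj₂ (inj₂ (f , p , ≢st , a)) })
      (addedOrRemoved-dec K K′ ⊎-dec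
       (∃ₑ-dec λ f → any? (λ v → ∋-dec K (src f) v ×-dec ∋-dec K v (tgt f)) ×-dec addedOrRemoved-dec K K′) ⊎-dec
       (∃ₑ-dec λ f → ∋-dec K s t ×-dec ¬? (src f ≟ s ×-dec tgt f ≟ t) ×-dec addedOrRemoved-dec K K′))

    moves-≗ : ∀ {e K K′} → K ≗ₑ K′ → Star (Move s t e) K K′
    moves-≗ K≗K′ = move-respʳ K≗K′ move-refl ◅ ε

    link-resp : ∀ {e K L K′ L′} → K ≗ₑ L → K′ ≗ₑ L′ → Link e K K′ → Link e L L′
    link-resp K≗L K′≗L′ (p , q) =
      moves-≗ (λ e → sym (K≗L e)) ◅◅ p ◅◅ moves-≗ K′≗L′ ,
      moves-≗ (λ e → sym (K′≗L′ e)) ◅◅ q ◅◅ moves-≗ K≗L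

    link-dec : ∀ e → Decidable (Link e)
    link-dec e K K′ = moves? K K′ ×-dec moves? K′ K
      where
      moves? : Decidable (Star (Move s t e))
      moves? = Star-dec (edgeSets N) move-refl move-respˡ move-respʳ (move-dec e)

    module _ {m : ℕ} (K : Fin m → KnowledgeSet N) where

      Linked : InputGraph N → Rel (Fin m) 0ℓ
      Linked G v w = ∃[ e ] (Link e (K v) (K w) × e ∈ₑ G)

      linked-sym : ∀ {G} → Symmetric (Linked G)
      linked-sym (e , (p , q) , e∈) = e , (q , p) , e∈

      private
        LinkedTriple : Pred (Fin m × Edge N × Fin m) 0ℓ
        LinkedTriple (v , e , w) = Link e (K v) (K w)

        linkedTriple-dec : ∀ x → Dec (LinkedTriple x)
        linkedTriple-dec (v , e , w) = link-dec e (K v) (K w)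

        triples : List (Fin m × Edge N × Fin m)
        triples = cartesianProduct (allFin m) (cartesianProduct (elements (allEdges N)) (allFin m))

      -- All edges that the given knowledge sets permit. More edges only help acceptance, so a
      -- search for a network of given size may range over knowledge sets and the two end vertices,
      -- without ranging over edge lists.
      linkNetwork : Fin m → Fin m → SwitchingNetwork N
      linkNetwork s′ t′ = record
        { size = m ; s′ = s′ ; t′ = t′ ; edges = List.filter linkedTriple-dec triples }

      adjacent⇒link : ∀ {s′ t′ v e w} → Adjacent (linkNetwork s′ t′) v e w → Link e (K v) (K w)
      adjacent⇒link (inj₁ a) = proj₂ (∈-filter⁻ linkedTriple-dec {xs = triples} a)
      adjacent⇒link (inj₂ a) with ∈-filter⁻ linkedTriple-dec {xs = triples} a
      ... | _ , p , q = q , p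

      link⇒adjacent : ∀ {s′ t′ v e w} → Link e (K v) (K w) → Adjacent (linkNetwork s′ t′) v e w
      link⇒adjacent {v = v} {e} {w} l = inj₁ (∈-filter⁺ linkedTriple-dec
        (∈-cartesianProduct⁺ (∈-allFin v) (∈-cartesianProduct⁺ (complete (allEdges N) e) (∈-allFin w))) l)

    module _ (I : Pred (InputGraph N) 0ℓ) where

      Solves : ∀ {m} → (Fin m → KnowledgeSet N) → Fin m → Fin m → Set
      Solves K s′ t′ =
        (∀ e → K s′ e ≡ false) × Star (K t′ ∋_⟶_) s t × (∀ G → I G → Star (Linked K G) s′ t′)

      Solvable : ℕ → Set
      Solvable m = Σ[ K ∈ (Fin m → KnowledgeSet N) ] ∃[ s′ ] ∃[ t′ ] Solves K s′ t′

      solvable⇒network : ∀ {m} → Solvable m →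
        ∃[ G′ ] (IsCertainKnowledge s t G′ × (∀ G → I G → Accepts G′ G) × size G′ ≡ m)
      solvable⇒network (K , s′ , t′ , empty , path , accepts) =
        linkNetwork K s′ t′ ,
        (K , empty , path , λ v e w a → proj₁ (adjacent⇒link K {s′} {t′} a)) ,
        (λ G G∈I → Star.map (λ (e , l , e∈) → e , link⇒adjacent K {s′} {t′} l , e∈) (accepts G G∈I)) ,
        refl

      network⇒solvable : ∀ G′ → IsCertainKnowledge s t G′ → (∀ G → I G → Accepts G′ G) → Solvable (size G′)
      network⇒solvable G′ (K , empty , path , moves) accepts =
        K , s′ G′ , t′ G′ , empty , path , λ G G∈I →
          Star.map (λ (e , a , e∈) → e , (moves _ e _ a , moves _ e _ (Sum.swap a)) , e∈) (accepts G G∈I)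

      module _ (I? : ∀ G → Dec (I G)) (I-resp : ∀ {G H} → G ≗ₑ H → I G → I H) where

        private
          linked-respᴳ : ∀ {m} {K : Fin m → KnowledgeSet N} {G H v w} → G ≗ₑ H → Linked K G v w → Linked K H v w
          linked-respᴳ G≗H (e , l , e∈) = e , l , subst T (G≗H e) e∈

          linked-respᴷ : ∀ {m} {K L : Fin m → KnowledgeSet N} {G v w} → Pointwise _≗ₑ_ K L →
                         Linked K G v w → Linked L G v w
          linked-respᴷ K≗L (e , l , e∈) = e , link-resp (K≗L _) (K≗L _) l , e∈

          linked-dec : ∀ {m} (K : Fin m → KnowledgeSet N) G → Decidable (Linked K G)
          linked-dec K G v w = ∃ₑ-dec λ e → link-dec e (K v) (K w) ×-dec T? (G e)

          reach-dec : ∀ {m} (K : Fin m → KnowledgeSet N) G → Decidable (Star (Linked K G))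
          reach-dec {m} K G v w = map′ (Star._⋆ strip) (Star.map inj₂)
            -- Equality is adjoined because `Star-dec` asks for a reflexive relation; reachability
            -- is unaffected.
            (Star-dec {R = λ v w → v ≡ w ⊎ Linked K G v w} (fins m)
              (inj₁ refl) (λ { refl p → p }) (λ { refl p → p })
              (λ v w → v ≟ w ⊎-dec linked-dec K G v w) v w)
            where
            strip : ∀ {v w} → v ≡ w ⊎ Linked K G v w → Star (Linked K G) v w
            strip (inj₁ refl) = ε
            strip (inj₂ l)    = l ◅ ε

          path-dec : ∀ (K : KnowledgeSet N) → Dec (Star (K ∋_⟶_) s t)
          path-dec K = map′ (Star._⋆ strip) (Star.map inj₂)
            (Star-dec {R = λ u v → u ≡ v ⊎ K ∋ u ⟶ v} (fins N)
              (inj₁ refl) (λ { refl p → p }) (λ { refl p → p })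
              (λ u v → u ≟ v ⊎-dec ∋-dec K u v) s t)
            where
            strip : ∀ {u v} → u ≡ v ⊎ K ∋ u ⟶ v → Star (K ∋_⟶_) u v
            strip (inj₁ refl) = ε
            strip (inj₂ a)    = a ◅ ε

          solves-dec : ∀ {m} (K : Fin m → KnowledgeSet N) s′ t′ → Dec (Solves K s′ t′)
          solves-dec K s′ t′ =
            (∀ₑ-dec λ e → K s′ e Bool.≟ false) ×-dec path-dec (K t′) ×-dec
            ∀-dec (edgeSets N)
              (λ G≗H acc H∈I → Star.map (linked-respᴳ {K = K} G≗H) (acc (I-resp (λ e → sym (G≗H e)) H∈I)))
              (λ G → I? G →-dec reach-dec K G s′ t′)

          solves-resp : ∀ {m} {K L : Fin m → KnowledgeSet N} {s′ t′} → Pointwise _≗ₑ_ K L →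
                        Solves K s′ t′ → Solves L s′ t′
          solves-resp K≗L (empty , path , acc) =
            (λ e → trans (sym (K≗L _ e)) (empty e)) ,
            Star.map (∋-resp (K≗L _)) path ,
            λ G G∈I → Star.map (linked-respᴷ K≗L) (acc G G∈I)

        solvable-dec : ∀ m → Dec (Solvable m)
        solvable-dec m = ∃-dec (functions (edgeSets N) m)
          (λ K≗L (s′ , t′ , sol) → s′ , t′ , solves-resp K≗L sol)
          (λ K → any? λ s′ → any? λ t′ → solves-dec K s′ t′)

        c-exists : ∀ {m} → Solvable m → ∃[ c ] (IsC s t I c × c ℕ.≤ m)
        c-exists {m} sol with least solvable-dec sol
        ... | c , sol-c , min = c , record
          { attained = solvable⇒network sol-c
          ; minimal  = λ G′ ck acc → min _ (network⇒solvable G′ ck acc)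
          } , min m sol

-- Interior vertices and path graphs

module PathGraphs where

  open FiniteSearch
  open LinkNetworks

  members : ∀ {N} (p : Subset N) → Fin ∣ p ∣ → Fin N
  members (true  ∷ p) zero    = zero
  members (true  ∷ p) (suc i) = suc (members p i)
  members (false ∷ p) i       = suc (members p i)

  members-∈ : ∀ {N} (p : Subset N) i → members p i Subset.∈ p
  members-∈ (true  ∷ p) zero    = here
  members-∈ (true  ∷ p) (suc i) = there (members-∈ p i)
  members-∈ (false ∷ p) i       = there (members-∈ p i)

  members-surjective : ∀ {N} {p : Subset N} {x} → x Subset.∈ p → ∃[ i ] members p i ≡ x
  members-surjective here = zero , refl
  members-surjective {p = true ∷ p} (there x∈) with members-surjective x∈
  ... | i , refl = suc i , refl
  members-surjective {p = false ∷ p} (there x∈) with members-surjective x∈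
  ... | i , refl = i , refl

  members-injective : ∀ {N} (p : Subset N) {i j} → members p i ≡ members p j → i ≡ j
  members-injective (true ∷ p) {zero}  {zero}  _ = refl
  members-injective (true ∷ p) {suc i} {suc j} eq = cong suc (members-injective p (suc-injective eq))
  members-injective (false ∷ p) eq = members-injective p (suc-injective eq)

  module _ {N : ℕ} (s t : Fin N) where

    interior : Fin #V∖[ s , t ] → Fin N
    interior = members (∁ (⁅ s ⁆ ∪ ⁅ t ⁆))

    private
      ∉-ends : ∀ i → ¬ (interior i Subset.∈ ⁅ s ⁆ ∪ ⁅ t ⁆)
      ∉-ends i = Subset.x∈∁p⇒x∉p (members-∈ _ i)

    interior≢s : ∀ i → interior i ≢ s
    interior≢s i eq = ∉-ends i (Subset.x∈p∪q⁺ (inj₁ (subst (Subset._∈ ⁅ s ⁆) (sym eq) (Subset.x∈⁅x⁆ s))))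

    interior≢t : ∀ i → interior i ≢ t
    interior≢t i eq = ∉-ends i (Subset.x∈p∪q⁺ (inj₂ (subst (Subset._∈ ⁅ t ⁆) (sym eq) (Subset.x∈⁅x⁆ t))))

    interior-surjective : ∀ {x} → x ≢ s → x ≢ t → ∃[ i ] interior i ≡ x
    interior-surjective x≢s x≢t = members-surjective (Subset.x∉p⇒x∈∁p λ x∈ →
      Sum.[ x≢s ∘ Subset.x∈⁅y⁆⇒x≡y s , x≢t ∘ Subset.x∈⁅y⁆⇒x≡y t ] (Subset.x∈p∪q⁻ ⁅ s ⁆ ⁅ t ⁆ x∈))

  -- Makes path positions plain natural numbers, as in the line game; positions beyond `j` are read
  -- as `j`.
  clamp : ∀ j → ℕ → Fin (suc j)
  clamp j       zero    = zero
  clamp zero    (suc p) = zero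
  clamp (suc j) (suc p) = suc (clamp j p)

  toℕ-clamp : ∀ j {p} → p ≤ j → toℕ (clamp j p) ≡ p
  toℕ-clamp j       z≤n     = refl
  toℕ-clamp (suc j) (s≤s p≤j) = cong suc (toℕ-clamp j p≤j)

  clamp-fromℕ : ∀ j → clamp j j ≡ fromℕ j
  clamp-fromℕ zero    = refl
  clamp-fromℕ (suc j) = cong suc (clamp-fromℕ j)

  clamp-toℕ : ∀ j i → clamp j (toℕ i) ≡ i
  clamp-toℕ j       zero    = refl
  clamp-toℕ (suc j) (suc i) = cong suc (clamp-toℕ j i)

  clamp-inject₁ : ∀ j (i : Fin j) → clamp j (toℕ i) ≡ inject₁ i
  clamp-inject₁ j i = trans (cong (clamp j) (sym (toℕ-inject₁ i))) (clamp-toℕ j (inject₁ i))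

  record PathGraph {N} (s t : Fin N) (j : ℕ) (w : ℕ → Fin N) (G : InputGraph N) : Set where
    field
      injective : ∀ {p q} → p ≤ j → q ≤ j → w p ≡ w q → p ≡ q
      start     : w 0 ≡ s
      end       : w j ≡ t
      edges⁻    : ∀ {e} → e ∈ₑ G → ∃[ p ] (p < j × src e ≡ w p × tgt e ≡ w (suc p))
      edges⁺    : ∀ {p} → p < j → ∃[ e ] (e ∈ₑ G × src e ≡ w p × tgt e ≡ w (suc p))

  𝒫⇒pathGraph : ∀ {N} {s t : Fin N} {j G} → 𝒫 s t j G → ∃[ w ] PathGraph s t j w G
  𝒫⇒pathGraph {j = j} {G} (v , inj , v0≡s , vj≡t , G⇔) = v ∘ clamp j , record
    { injective = inj′
    ; start     = v0≡s
    ; end       = trans (cong v (clamp-fromℕ j)) vj≡t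
    ; edges⁻    = λ {e} e∈ → let i , src≡ , tgt≡ = Equivalence.to (G⇔ e) e∈ in
        toℕ i , toℕ<n i , trans src≡ (cong v (sym (clamp-inject₁ j i))) ,
        trans tgt≡ (cong v (sym (clamp-toℕ j (suc i))))
    ; edges⁺    = λ {p} p<j →
        let i = fromℕ< p<j
            p≡ = toℕ-fromℕ< p<j
            e = edge (v (clamp j p)) (v (clamp j (suc p)))
                  (λ eq → ℕ.1+n≢n (sym (inj′ (ℕ.<⇒≤ p<j) p<j eq)))
            src≡ = cong v (trans (cong (clamp j) (sym p≡)) (clamp-inject₁ j i))
            tgt≡ = cong v (trans (cong (clamp j ∘ suc) (sym p≡)) (clamp-toℕ j (suc i)))
        in e , Equivalence.from (G⇔ e) (i , src≡ , tgt≡) , refl , refl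
    }
    where
    inj′ : ∀ {p q} → p ≤ j → q ≤ j → v (clamp j p) ≡ v (clamp j q) → p ≡ q
    inj′ p≤j q≤j eq = trans (sym (toℕ-clamp j p≤j)) (trans (cong toℕ (inj eq)) (toℕ-clamp j q≤j))

  graphOf : ∀ {N} l → (Fin (suc l) → Fin N) → InputGraph N
  graphOf l v e = ⌊ any? (λ i → src e ≟ v (inject₁ i) ×-dec tgt e ≟ v (suc i)) ⌋

  graphOf-⇔ : ∀ {N} l (v : Fin (suc l) → Fin N) e →
    e ∈ₑ graphOf l v ⇔ (∃[ i ] (src e ≡ v (inject₁ i) × tgt e ≡ v (suc i)))
  graphOf-⇔ l v e = mk⇔ toWitness fromWitness

  𝒫-dec : ∀ {N} (s t : Fin N) l G → Dec (𝒫 s t l G)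
  𝒫-dec {N} s t l G = ∃-dec (functions (fins N) (suc l))
    (λ {v} {v′} v≗ (inj , v0 , vl , G⇔) →
      (λ {i} {j} eq → inj (trans (v≗ i) (trans eq (sym (v≗ j))))) ,
      trans (sym (v≗ zero)) v0 ,
      trans (sym (v≗ _)) vl ,
      λ e → mk⇔
        (λ e∈ → let i , p , q = Equivalence.to (G⇔ e) e∈ in i , trans p (v≗ _) , trans q (v≗ _))
        (λ (i , p , q) → Equivalence.from (G⇔ e) (i , trans p (sym (v≗ _)) , trans q (sym (v≗ _)))))
    (λ v → injective? v ×-dec v zero ≟ s ×-dec v (fromℕ l) ≟ t ×-dec
      ∀ₑ-dec λ e → ⇔-dec (T? (G e)) (any? λ i → src e ≟ v (inject₁ i) ×-dec tgt e ≟ v (suc i)))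
    where
    injective? : ∀ v → Dec (∀ {i j} → v i ≡ v j → i ≡ j)
    injective? v = map′ (λ f {i} {j} → f i j) (λ f i j → f) (all? λ i → all? λ j → v i ≟ v j →-dec i ≟ j)

  𝒫-resp : ∀ {N} {s t : Fin N} {l G H} → G ≗ₑ H → 𝒫 s t l G → 𝒫 s t l H
  𝒫-resp G≗H (v , inj , v0 , vl , G⇔) = v , inj , v0 , vl , λ e → subst (λ b → T b ⇔ _) (G≗H e) (G⇔ e)

  𝒫≤-dec : ∀ {N} (s t : Fin N) l G → Dec (𝒫≤ s t l G)
  𝒫≤-dec s t l G = map′
    (λ (i , 1≤ , P) → toℕ i , 1≤ , ℕ.s≤s⁻¹ (toℕ<n i) , P)
    (λ (j , 1≤ , j≤l , P) → clamp l j , subst (λ j → 1 ≤ j × 𝒫 s t j G) (sym (toℕ-clamp l j≤l)) (1≤ , P))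
    (any? λ i → 1 ℕ.≤? toℕ i ×-dec 𝒫-dec s t (toℕ i) G)

  𝒫≤-resp : ∀ {N} {s t : Fin N} {l G H} → G ≗ₑ H → 𝒫≤ s t l G → 𝒫≤ s t l H
  𝒫≤-resp G≗H (j , 1≤ , ≤l , P) = j , 1≤ , ≤l , 𝒫-resp G≗H P

-- Upper bound by reversible pebbling

module UpperBound where

  open FiniteSearch
  open LinkNetworks
  open PathGraphs
  open LineGame using (pow; 0<pow)

  T-≡ : ∀ {a b} → (T a → T b) → (T b → T a) → a ≡ b
  T-≡ {true}  {true}  f g = refl
  T-≡ {true}  {false} f g = ⊥-elim (f _)
  T-≡ {false} {true}  f g = ⊥-elim (g _)
  T-≡ {false} {false} f g = refl

  infixl 6 _⊕_
  _⊕_ : ∀ {N} → EdgeSet N → Edge N → EdgeSet N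
  (K ⊕ f) e = K e ∨ ⌊ e ≟ₑ f ⌋

  ∈-⊕ : ∀ {N} (K : EdgeSet N) f e → e ∈ₑ K ⊕ f ⇔ (e ∈ₑ K ⊎ e ≡ f)
  ∈-⊕ K f e = mk⇔
    (λ e∈ → Sum.map₂ (toWitness {a? = e ≟ₑ f}) (Equivalence.to (T-∨ {K e}) e∈))
    (λ e∈ → Equivalence.from (T-∨ {K e}) (Sum.map₂ (fromWitness {a? = e ≟ₑ f}) e∈))

  ∋-⊕ : ∀ {N} {K : EdgeSet N} {f u v} → K ∋ u ⟶ v → K ⊕ f ∋ u ⟶ v
  ∋-⊕ {K = K} {f} (e , e∈ , eqs) = e , Equivalence.from (∈-⊕ K f e) (inj₁ e∈) , eqs

  ⊕-∋ : ∀ {N} {K : EdgeSet N} f → K ⊕ f ∋ src f ⟶ tgt f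
  ⊕-∋ {K = K} f = f , Equivalence.from (∈-⊕ K f f) (inj₂ refl) , refl , refl

  ⊕-absorb : ∀ {N} {K : EdgeSet N} {f} → f ∈ₑ K → K ≗ₑ K ⊕ f
  ⊕-absorb {K = K} {f} f∈ e = T-≡ (Equivalence.from (∈-⊕ K f e) ∘ inj₁)
    λ e∈ → Sum.[ (λ e∈ → e∈) , (λ { refl → f∈ }) ]′ (Equivalence.to (∈-⊕ K f e) e∈)

  -- If `f` was already present, the way back is to add it once more; removing it would overshoot.
  added-sym : ∀ {N} {f : Edge N} {K L} → Added f K L → AddedOrRemoved f L K
  added-sym {f = f} {K} K+f≡L with T? (K f)
  ... | yes f∈ = inj₁ λ e → mk⇔ (inj₁ ∘ Equivalence.from (K+f≡L e) ∘ inj₁)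
                   λ { (inj₁ e∈) → Sum.[ (λ e∈ → e∈) , (λ { refl → f∈ }) ]′ (Equivalence.to (K+f≡L e) e∈)
                     ; (inj₂ refl) → f∈ }
  ... | no f∉  = inj₂ λ e → mk⇔
                   (λ e∈ → Equivalence.from (K+f≡L e) (inj₁ e∈) , λ { refl → f∉ e∈ })
                   λ (e∈ , e≢f) → Sum.[ (λ e∈ → e∈) , (λ e≡f → ⊥-elim (e≢f e≡f)) ]′ (Equivalence.to (K+f≡L e) e∈)

  module _ {N : ℕ} {s t : Fin N} where

    link-sym : ∀ {e K L} → Link s t e K L → Link s t e L K
    link-sym (p , q) = q , p

    link-trans : ∀ {e K L M} → Link s t e K L → Link s t e L M → Link s t e K M
    link-trans (p , q) (p′ , q′) = p ◅◅ p′ , q′ ◅◅ q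

    link-≗ : ∀ {e K L} → K ≗ₑ L → Link s t e K L
    link-≗ K≗L = moves-≗ s t K≗L , moves-≗ s t (λ e → sym (K≗L e))

    link-see : ∀ {e K} → Link s t e K (K ⊕ e)
    link-see {e} {K} = see (inj₁ (∈-⊕ K e)) ◅ ε , see (added-sym (∈-⊕ K e)) ◅ ε

    link-transitive : ∀ {e K v} f → K ∋ src f ⟶ v → K ∋ v ⟶ tgt f → Link s t e K (K ⊕ f)
    link-transitive {K = K} f p q =
      transitive f p q (inj₁ (∈-⊕ K f)) ◅ ε , transitive f (∋-⊕ p) (∋-⊕ q) (added-sym (∈-⊕ K f)) ◅ ε

    -- Knowing `s → t` frees every other edge, so `K` is turned into `L` edge by edge; `agree` says
    -- that the edges no longer listed are settled.
    goal-moves : ∀ {e K L} → K ∋ s ⟶ t → L ∋ s ⟶ t → Star (Move s t e) K L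
    goal-moves {e} {L = L} K∋ L∋ = go (Enumeration.elements (allEdges N)) K∋
      (λ f → inj₁ (Enumeration.complete (allEdges N) f))
      where
      go : ∀ {K} es → K ∋ s ⟶ t → (∀ f → f ∈ es ⊎ K f ≡ L f) → Star (Move s t e) K L
      go [] K∋ agree = moves-≗ s t λ f → Sum.[ (λ ()) , (λ eq → eq) ] (agree f)
      go {K} (f ∷ es) K∋@(g , g∈ , refl , refl) agree with g ≟ₑ f
      -- The edge `s → t` itself is out of reach of goal moves, but both sets contain it.
      ... | yes refl = go es K∋ λ h → rest (agree h)
        where
        L∋f : T (L g)
        L∋f = let g′ , g′∈ , p , q = L∋ in subst (λ h → T (L h)) (Edge-≡ p q) g′∈
        rest : ∀ {h} → h ∈ g ∷ es ⊎ K h ≡ L h → h ∈ es ⊎ K h ≡ L h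
        rest (inj₁ (here refl)) = inj₂ (T-≡ (λ _ → L∋f) (λ _ → g∈))
        rest (inj₁ (there h∈))  = inj₁ h∈
        rest (inj₂ eq)          = inj₂ eq
      ... | no g≢f = goal f K∋ (λ (p , q) → g≢f (sym (Edge-≡ p q))) K→K′ ◅
                     go es (g , subst T (sym (off g g≢f)) g∈ , refl , refl) agree′
        where
        K′ : EdgeSet N
        K′ h with h ≟ₑ f
        ... | yes _ = L h
        ... | no _  = K h
        off : ∀ h → h ≢ f → K′ h ≡ K h
        off h h≢f with h ≟ₑ f
        ... | yes h≡f = ⊥-elim (h≢f h≡f)
        ... | no _    = refl
        on : K′ f ≡ L f
        on with f ≟ₑ f
        ... | yes _  = refl
        ... | no f≢f = ⊥-elim (f≢f refl)
        K→K′ : AddedOrRemoved f K K′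
        K→K′ with T? (L f)
        ... | yes f∈ = inj₁ λ h → mk⇔ (to h) (from h)
          where
          to : ∀ h → T (K′ h) → T (K h) ⊎ h ≡ f
          to h h∈ with h ≟ₑ f
          ... | yes h≡f = inj₂ h≡f
          ... | no _    = inj₁ h∈
          from : ∀ h → T (K h) ⊎ h ≡ f → T (K′ h)
          from h h∈ with h ≟ₑ f
          from h _         | yes refl = f∈
          from h (inj₁ h∈) | no _ = h∈
          from h (inj₂ h≡f) | no h≢f = ⊥-elim (h≢f h≡f)
        ... | no f∉ = inj₂ λ h → mk⇔ (to h) λ (h∈ , h≢f) → subst T (sym (off h h≢f)) h∈
          where
          to : ∀ h → T (K′ h) → T (K h) × h ≢ f
          to h h∈ with h ≟ₑ f
          ... | yes refl = ⊥-elim (f∉ h∈)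
          ... | no h≢f   = h∈ , h≢f
        agree′ : ∀ h → h ∈ es ⊎ K′ h ≡ L h
        agree′ h with h ≟ₑ f | agree h
        ... | yes refl | _                   = inj₂ refl
        ... | no h≢f   | inj₁ (here h≡f)     = ⊥-elim (h≢f h≡f)
        ... | no _     | inj₁ (there h∈)     = inj₁ h∈
        ... | no _     | inj₂ eq             = inj₂ eq

    link-goal : ∀ {e K L} → K ∋ s ⟶ t → L ∋ s ⟶ t → Link s t e K L
    link-goal K∋ L∋ = goal-moves K∋ L∋ , goal-moves L∋ K∋

  -- The default serves as padding: it extends a list of pebbled vertices to a tuple of exactly `k`
  -- entries.
  nth : ∀ {A : Set} → A → List A → ℕ → A
  nth x []       i       = x
  nth x (y ∷ ys) zero    = y
  nth x (y ∷ ys) (suc i) = nth x ys i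

  nth-∈ : ∀ {A : Set} (x : A) ys i → nth x ys i ∈ x ∷ ys
  nth-∈ x []       i       = here refl
  nth-∈ x (y ∷ ys) zero    = there (here refl)
  nth-∈ x (y ∷ ys) (suc i) with nth-∈ x ys i
  ... | here eq = here eq
  ... | there y∈ = there (there y∈)

  nth-surjective : ∀ {A : Set} (x : A) {ys y} → y ∈ ys → ∃[ i ] (i < length ys × nth x ys i ≡ y)
  nth-surjective x (here refl) = 0 , s≤s z≤n , refl
  nth-surjective x (there y∈) with nth-surjective x y∈
  ... | i , i< , eq = suc i , s≤s i< , eq

  module Pebbling {N : ℕ} (s t : Fin N) (s≢t : s ≢ t) (k : ℕ) where

    n : ℕ
    n = #V∖[ s , t ]

    Pebbled : (Fin k → Fin n) → EdgeSet N
    Pebbled f e = ⌊ src e ≟ s ×-dec any? (λ j → tgt e ≟ interior s t (f j)) ⌋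

    ∈-Pebbled : ∀ f e → e ∈ₑ Pebbled f ⇔ (src e ≡ s × ∃[ j ] tgt e ≡ interior s t (f j))
    ∈-Pebbled f e = mk⇔ toWitness fromWitness

    -- The source, the target, and the tuples of pebbled vertices; a repeated entry
    -- stands for an unused pebble.
    knowledge : Fin (2 + n ℕ.^ k) → KnowledgeSet N
    knowledge zero          _ = false
    knowledge (suc zero)    _ = true
    knowledge (suc (suc i)) = Pebbled (finToFun i)

    module _ {j : ℕ} {w : ℕ → Fin N} {G : InputGraph N} (path : PathGraph s t j w G) where

      open PathGraph path

      private
        _⇝_ : Rel (Fin (2 + n ℕ.^ k)) 0ℓ
        _⇝_ = Star (Linked s t knowledge G)

      Represents : Fin (2 + n ℕ.^ k) → List ℕ → Set
      Represents v S = ∀ e → e ∈ₑ knowledge v ⇔ (src e ≡ s × ∃[ p ] (p ∈ S × tgt e ≡ w p))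

      Inner : ℕ → Set
      Inner p = 0 < p × p < j

      w≢s : ∀ {p} → Inner p → w p ≢ s
      w≢s (0<p , p<j) eq = ℕ.<⇒≢ 0<p (injective z≤n (ℕ.<⇒≤ p<j) (trans start (sym eq)))

      w≢t : ∀ {p} → Inner p → w p ≢ t
      w≢t (0<p , p<j) eq = ℕ.<⇒≢ p<j (injective (ℕ.<⇒≤ p<j) ℕ.≤-refl (trans eq (sym end)))

      index : ∀ {p} → Inner p → ∃[ i ] interior s t i ≡ w p
      index p-inner = interior-surjective s t (w≢s p-inner) (w≢t p-inner)

      represented : ∀ S → All Inner S → length S ≤ k → ∃[ v ] Represents v S
      represented [] _ _ = zero , λ e → mk⇔ (λ ()) λ { (_ , _ , () , _) }
      represented S@(p ∷ ps) inner ∣S∣≤k = suc (suc (funToFin f)) , λ e → mk⇔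
        (λ e∈ → let src≡ , i , tgt≡ = Equivalence.to (∈-Pebbled _ e) e∈ in
          src≡ , pos i , nth-∈ p ps (toℕ i) , trans tgt≡ (trans (cong (interior s t) (finToFun-funToFin f i)) (f-pos i)))
        (λ (src≡ , q , q∈ , tgt≡) → Equivalence.from (∈-Pebbled _ e) (src≡ ,
          let i , pos≡ = pos-surjective q∈ in
          i , trans tgt≡ (trans (cong w (sym pos≡)) (sym (trans (cong (interior s t) (finToFun-funToFin f i)) (f-pos i))))))
        where
        pos : Fin k → ℕ
        pos i = nth p ps (toℕ i)
        pos-inner : ∀ i → Inner (pos i)
        pos-inner i = All.lookup inner (nth-∈ p ps (toℕ i))
        f : Fin k → Fin n
        f i = proj₁ (index (pos-inner i))
        f-pos : ∀ i → interior s t (f i) ≡ w (pos i)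
        f-pos i = proj₂ (index (pos-inner i))
        at : ∀ {i q} → i < k → nth p ps i ≡ q → ∃[ i ] pos i ≡ q
        at i<k eq = fromℕ< i<k , trans (cong (nth p ps) (toℕ-fromℕ< i<k)) eq
        nth-length : ∀ qs → nth p qs (length qs) ≡ p
        nth-length []       = refl
        nth-length (q ∷ qs) = nth-length qs
        pos-surjective : ∀ {q} → q ∈ S → ∃[ i ] pos i ≡ q
        -- The head is the padding value and first appears as such at index `length ps`, which is
        -- below `k`.
        pos-surjective (here refl) = at ∣S∣≤k (nth-length ps)
        pos-surjective (there q∈) with nth-surjective p q∈
        ... | i , i< , eq = at (ℕ.<-trans i< ∣S∣≤k) eq

      Available : ℕ → List ℕ → Set
      Available p S = p ≡ 0 ⊎ p ∈ S

      private
        fact : ∀ v {S} q → Represents v S → q ∈ S → s ≢ w q → knowledge v ∋ s ⟶ w q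
        fact v q rep q∈ s≢ = f , Equivalence.from (rep f) (refl , q , q∈ , refl) , refl , refl
          where
          f : Edge N
          f = edge s (w q) s≢

      -- Composing the known edge `s → w p` with the seen edge `e` yields `f`. For `p ≡ 0` the seen
      -- edge is already `f`, and adding it again has no effect.
      link-advance : ∀ v {S e p} → Represents v S → Available p S → Inner p ⊎ p ≡ 0 → src e ≡ w p →
        ∀ f → src f ≡ s → tgt f ≡ tgt e → Link s t e (knowledge v) (knowledge v ⊕ e ⊕ f)
      link-advance v {e = e} {p} rep avail inner src≡ f sf tf with p ℕ.≟ 0
      ... | yes refl = link-trans link-see (link-≗ (⊕-absorb {K = knowledge v ⊕ e} (subst (_∈ₑ (knowledge v ⊕ e))
                         (Edge-≡ (trans src≡ (trans start (sym sf))) (sym tf)) (proj₁ (proj₂ (⊕-∋ {K = knowledge v} e))))))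
      link-advance v {e = e} {p} rep (inj₂ p∈) (inj₁ inner) src≡ f sf tf | no _ =
        link-trans link-see (link-transitive f
          (subst (λ u → knowledge v ⊕ e ∋ u ⟶ w p) (sym sf) (∋-⊕ (fact v p rep p∈ (w≢s inner ∘ sym))))
          (subst₂ (λ x y → knowledge v ⊕ e ∋ x ⟶ y) src≡ (sym tf) (⊕-∋ e)))
      link-advance v rep (inj₁ p≡0) _ _ _ _ _ | no p≢0 = ⊥-elim (p≢0 p≡0)
      link-advance v rep _ (inj₂ p≡0) _ _ _ _ | no p≢0 = ⊥-elim (p≢0 p≡0)

      -- The seen edge has to be forgotten after deriving `f`: up to order, the set reached is
      -- `knowledge v′` together with `e`, so a see move in reverse finishes.
      place-link : ∀ v v′ {S e p} → Represents v S → Represents v′ (suc p ∷ S) → Available p S →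
        Inner p ⊎ p ≡ 0 → Inner (suc p) → src e ≡ w p → tgt e ≡ w (suc p) →
        Link s t e (knowledge v) (knowledge v′)
      place-link v v′ {S} {e} {p} rep rep′ avail inner inner′ src≡ tgt≡ =
        link-trans (link-advance v rep avail inner src≡ f refl (sym tgt≡))
          (link-trans (link-≗ swap) (link-sym (link-trans (link-≗ v′≗) link-see)))
        where
        f : Edge N
        f = edge s (w (suc p)) (w≢s inner′ ∘ sym)
        swap : knowledge v ⊕ e ⊕ f ≗ₑ knowledge v ⊕ f ⊕ e
        swap h = trans (Bool.∨-assoc (knowledge v h) _ _)
          (trans (cong (knowledge v h ∨_) (Bool.∨-comm ⌊ h ≟ₑ e ⌋ ⌊ h ≟ₑ f ⌋)) (sym (Bool.∨-assoc (knowledge v h) _ _)))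
        v′≗ : knowledge v′ ≗ₑ knowledge v ⊕ f
        v′≗ h = T-≡
          (λ h∈ → Equivalence.from (∈-⊕ (knowledge v) f h) (to (Equivalence.to (rep′ h) h∈)))
          (λ h∈ → Equivalence.from (rep′ h) (from (Equivalence.to (∈-⊕ (knowledge v) f h) h∈)))
          where
          to : src h ≡ s × ∃[ q ] (q ∈ suc p ∷ S × tgt h ≡ w q) → T (knowledge v h) ⊎ h ≡ f
          to (src≡s , _ , here refl , tgt≡) = inj₂ (Edge-≡ src≡s tgt≡)
          to (src≡s , q , there q∈ , tgt≡)  = inj₁ (Equivalence.from (rep h) (src≡s , q , q∈ , tgt≡))
          from : T (knowledge v h) ⊎ h ≡ f → src h ≡ s × ∃[ q ] (q ∈ suc p ∷ S × tgt h ≡ w q)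
          from (inj₁ h∈) = let src≡s , q , q∈ , tgt≡ = Equivalence.to (rep h) h∈ in src≡s , q , there q∈ , tgt≡
          from (inj₂ refl) = refl , suc p , here refl , refl

      finish-link : ∀ v {S e p} → Represents v S → Available p S →
        Inner p ⊎ p ≡ 0 → src e ≡ w p → tgt e ≡ t → Link s t e (knowledge v) (knowledge (suc zero))
      finish-link v rep avail inner src≡ tgt≡ =
        link-trans (link-advance v rep avail inner src≡ (edge s t s≢t) refl (sym tgt≡))
          (link-goal (⊕-∋ (edge s t s≢t)) (edge s t s≢t , _ , refl , refl))

      swap-represented : ∀ v {S p q} → Represents v (p ∷ q ∷ S) → Represents v (q ∷ p ∷ S)
      swap-represented v rep e = mk⇔
        (λ e∈ → let src≡ , r , r∈ , tgt≡ = Equivalence.to (rep e) e∈ in src≡ , r , swap r∈ , tgt≡)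
        (λ (src≡ , r , r∈ , tgt≡) → Equivalence.from (rep e) (src≡ , r , swap r∈ , tgt≡))
        where
        swap : ∀ {p q r S} → r ∈ p ∷ q ∷ S → r ∈ q ∷ p ∷ S
        swap (here eq)          = there (here eq)
        swap (there (here eq))  = here eq
        swap (there (there r∈)) = there (there r∈)

      -- Bennett's reversible pebbling: walk to the midpoint, from there to x,
      -- then undo the first half.
      place : ∀ i {p d x S} v v′ → x ≡ p + d → 0 < d → d ≤ pow i → x < j →
        Available p S → Inner p ⊎ p ≡ 0 → All Inner S → length S + suc i ≤ k →
        Represents v S → Represents v′ (x ∷ S) → v ⇝ v′
      place zero {p} {suc d} v v′ refl 0<d (s≤s d≤0) x<j avail inner _ _ rep rep′ with ℕ.n≤0⇒n≡0 d≤0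
      ... | refl rewrite ℕ.+-comm p 1 =
        let e , e∈ , src≡ , tgt≡ = edges⁺ (ℕ.<-trans ℕ.≤-refl x<j)
        in (e , place-link v v′ rep rep′ avail inner (s≤s z≤n , x<j) src≡ tgt≡ , e∈) ◅ ε
      place (suc i) {p} {d} {x} {S} v v′ refl 0<d d≤ x<j avail inner allInner budget rep rep′ with d ℕ.≤? pow i
      ... | yes d≤pow = place i v v′ refl 0<d d≤pow x<j avail inner allInner
                          (ℕ.≤-trans (ℕ.+-monoʳ-≤ (length S) (ℕ.n≤1+n _)) budget) rep rep′
      ... | no d≰pow =
        place i v v₁ refl (0<pow i) ℕ.≤-refl mid<j avail inner allInner budget₁ rep rep₁ ◅◅
        place i v₁ v₂ split 0<d′ d′≤ x<j (inj₂ (here refl)) (inj₁ mid-inner) (mid-inner ∷ allInner) budget₂ rep₁ rep₂ ◅◅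
        reverse (λ {x} {y} → linked-sym s t knowledge {G} {x} {y})
          (place i v′ v₂ refl (0<pow i) ℕ.≤-refl mid<j (Sum.map₂ there avail) inner
            (x-inner ∷ allInner) budget₂ rep′ (swap-represented v₂ rep₂))
        where
        mid d′ : ℕ
        mid = p + pow i
        d′  = d ℕ.∸ pow i
        pow+d′ : pow i + d′ ≡ d
        pow+d′ = ℕ.m+[n∸m]≡n (ℕ.≰⇒≥ d≰pow)
        split : p + d ≡ mid + d′
        split = trans (cong (p ℕ.+_) (sym pow+d′)) (sym (ℕ.+-assoc p (pow i) d′))
        0<d′ : 0 < d′
        0<d′ = ℕ.m<n⇒0<n∸m (ℕ.≰⇒> d≰pow)
        d′≤ : d′ ≤ pow i
        d′≤ = ℕ.+-cancelˡ-≤ (pow i) _ _ (ℕ.≤-trans (ℕ.≤-reflexive pow+d′) d≤)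
        mid<j : mid < j
        mid<j = ℕ.<-trans (ℕ.+-monoʳ-< p (ℕ.≰⇒> d≰pow)) x<j
        mid-inner : Inner mid
        mid-inner = ℕ.≤-trans (0<pow i) (ℕ.m≤n+m _ p) , mid<j
        x-inner : Inner x
        x-inner = ℕ.≤-trans 0<d (ℕ.m≤n+m _ p) , x<j
        budget₁ : length S + suc i ≤ k
        budget₁ = ℕ.≤-trans (ℕ.+-monoʳ-≤ (length S) (ℕ.n≤1+n _)) budget
        budget₂ : suc (length S) + suc i ≤ k
        budget₂ = ℕ.≤-trans (ℕ.≤-reflexive (sym (ℕ.+-suc (length S) (suc i)))) budget
        ∣S∣+2≤k : suc (suc (length S)) ≤ k
        ∣S∣+2≤k = ℕ.≤-trans (s≤s (ℕ.≤-trans (ℕ.≤-reflexive (ℕ.+-comm 1 (length S))) (ℕ.+-monoʳ-≤ (length S) (s≤s z≤n)))) budget₂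
        mid-state : ∃[ v ] Represents v (mid ∷ S)
        mid-state = represented (mid ∷ S) (mid-inner ∷ allInner) (ℕ.<⇒≤ ∣S∣+2≤k)
        v₁ : Fin (2 + n ℕ.^ k)
        v₁ = proj₁ mid-state
        rep₁ : Represents v₁ (mid ∷ S)
        rep₁ = proj₂ mid-state
        both-state : ∃[ v ] Represents v (x ∷ mid ∷ S)
        both-state = represented (x ∷ mid ∷ S) (x-inner ∷ mid-inner ∷ allInner) ∣S∣+2≤k
        v₂ : Fin (2 + n ℕ.^ k)
        v₂ = proj₁ both-state
        rep₂ : Represents v₂ (x ∷ mid ∷ S)
        rep₂ = proj₂ both-state

      -- One pebble fewer than `place` over the same distance: the target takes no pebble, and the
      -- midpoint pebble need not be cleared afterwards. This is how `k` pebbles reach distance 2^k.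
      finish : ∀ i {p d S} v → j ≡ p + d → 0 < d → d ≤ pow i →
        Available p S → Inner p ⊎ p ≡ 0 → All Inner S → length S + i ≤ k →
        Represents v S → v ⇝ suc zero
      finish zero {p} {suc d} v refl 0<d (s≤s d≤0) avail inner _ _ rep with ℕ.n≤0⇒n≡0 d≤0
      ... | refl =
        let e , e∈ , src≡ , tgt≡ = edges⁺ (ℕ.≤-reflexive (ℕ.+-comm 1 p))
        in (e , finish-link v rep avail inner src≡ (trans tgt≡ (trans (cong w (ℕ.+-comm 1 p)) end)) , e∈) ◅ ε
      finish (suc i) {p} {d} {S} v j≡ 0<d d≤ avail inner allInner budget rep with d ℕ.≤? pow i
      ... | yes d≤pow = finish i v j≡ 0<d d≤pow avail inner allInner
                          (ℕ.≤-trans (ℕ.+-monoʳ-≤ (length S) (ℕ.n≤1+n _)) budget) rep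
      ... | no d≰pow =
        place i v v₁ refl (0<pow i) ℕ.≤-refl mid<j avail inner allInner budget rep rep₁ ◅◅
        finish i v₁ split 0<d′ d′≤ (inj₂ (here refl)) (inj₁ mid-inner) (mid-inner ∷ allInner) budget₁ rep₁
        where
        mid d′ : ℕ
        mid = p + pow i
        d′  = d ℕ.∸ pow i
        pow+d′ : pow i + d′ ≡ d
        pow+d′ = ℕ.m+[n∸m]≡n (ℕ.≰⇒≥ d≰pow)
        split : j ≡ mid + d′
        split = trans j≡ (trans (cong (p ℕ.+_) (sym pow+d′)) (sym (ℕ.+-assoc p (pow i) d′)))
        0<d′ : 0 < d′
        0<d′ = ℕ.m<n⇒0<n∸m (ℕ.≰⇒> d≰pow)
        d′≤ : d′ ≤ pow i
        d′≤ = ℕ.+-cancelˡ-≤ (pow i) _ _ (ℕ.≤-trans (ℕ.≤-reflexive pow+d′) d≤)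
        mid<j : mid < j
        mid<j = ℕ.<-≤-trans (ℕ.m<m+n mid 0<d′) (ℕ.≤-reflexive (sym split))
        mid-inner : Inner mid
        mid-inner = ℕ.≤-trans (0<pow i) (ℕ.m≤n+m _ p) , mid<j
        budget₁ : suc (length S) + i ≤ k
        budget₁ = ℕ.≤-trans (ℕ.≤-reflexive (sym (ℕ.+-suc (length S) i))) budget
        mid-state : ∃[ v ] Represents v (mid ∷ S)
        mid-state = represented (mid ∷ S) (mid-inner ∷ allInner)
          (ℕ.≤-trans (ℕ.m≤m+n (suc (length S)) i) budget₁)
        v₁ : Fin (2 + n ℕ.^ k)
        v₁ = proj₁ mid-state
        rep₁ : Represents v₁ (mid ∷ S)
        rep₁ = proj₂ mid-state

      accepts : 0 < j → j ≤ pow k → zero ⇝ suc zero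
      accepts 0<j j≤ = finish k zero refl 0<j j≤ (inj₁ refl) (inj₂ refl) [] ℕ.≤-refl
        (proj₂ (represented [] [] z≤n))

    solvable : ∀ {l} → l ≤ pow k → Solvable s t (𝒫≤ s t l) (2 + n ℕ.^ k)
    solvable l≤ = knowledge , zero , suc zero ,
      (λ _ → refl) ,
      (edge s t s≢t , _ , refl , refl) ◅ ε ,
      λ G (j , 1≤j , j≤l , P) → accepts (proj₂ (𝒫⇒pathGraph P)) 1≤j (ℕ.≤-trans j≤l l≤)

-- From network walks to the line game

module PathKnowledge where

  open FiniteSearch
  open LinkNetworks
  open PathGraphs
  open LineGame

  mentions? : ∀ {N} (X : EdgeSet N) u → Dec (∃[ e ] (e ∈ₑ X × (src e ≡ u ⊎ tgt e ≡ u)))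
  mentions? X u = ∃ₑ-dec λ e → T? (X e) ×-dec (src e ≟ u ⊎-dec tgt e ≟ u)

  -- The count covers the inner positions 1 to `pow k`, the interval to which `threat-free k` is
  -- applied.
  record Crowded {N} (w : ℕ → Fin N) (l k : ℕ) (X : KnowledgeSet N) : Set where
    field
      onPath : ∀ {e} → e ∈ₑ X → ∃[ p ] ∃[ q ] (p < q × q ≤ l × src e ≡ w p × tgt e ≡ w q)
      many   : k < count (λ p → ⌊ mentions? X (w p) ⌋) 0 (pow k)

  module _ {N : ℕ} {s t : Fin N} {l : ℕ} {w : ℕ → Fin N} {G : InputGraph N}
           (path : PathGraph s t l w G) where

    open PathGraph path
    open State

    state : KnowledgeSet N → State
    state X = record
      { R    = λ p q → p < q × q ≤ l × X ∋ w p ⟶ w q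
      ; S    = λ p → ⌊ mentions? X (w p) ⌋
      ; R⇒<  = proj₁
      ; src∈ = λ (_ , _ , e , e∈ , src≡ , _) → fromWitness (e , e∈ , inj₁ src≡)
      ; tgt∈ = λ (_ , _ , e , e∈ , _ , tgt≡) → fromWitness (e , e∈ , inj₂ tgt≡)
      }

    OnPath : KnowledgeSet N → Set
    OnPath X = ∀ {e} → e ∈ₑ X → ∃[ p ] ∃[ q ] (p < q × q ≤ l × src e ≡ w p × tgt e ≡ w q)

    Reaches : ℕ → KnowledgeSet N → Rel ℕ 0ℓ
    Reaches i X = Star (Seen i (R (state X)))

    Equivalent : ℕ → KnowledgeSet N → KnowledgeSet N → Set
    Equivalent i X Y = Implies i (state X) (state Y) × Implies i (state Y) (state X)

    implies-path : ∀ {i X Y p q} → Implies i (state X) (state Y) → Reaches i Y p q → Reaches i X p q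
    implies-path f = Star._⋆ λ { (inj₁ r) → f r ; (inj₂ e) → inj₂ e ◅ ε }

    equivalent-trans : ∀ {i X Y Z} → Equivalent i X Y → Equivalent i Y Z → Equivalent i X Z
    equivalent-trans {X = X} {Y} {Z} (f , g) (f′ , g′) =
      (λ r → implies-path {X = X} {Y} f (f′ r)) , λ r → implies-path {X = Z} {Y} g′ (g r)

    edge-between : ∀ {X p q} → OnPath X → (r : X ∋ w p ⟶ w q) → p ≤ l → q ≤ l → R (state X) p q
    edge-between on r@(e , e∈ , src≡ , tgt≡) p≤l q≤l with on e∈
    ... | a , c , a<c , c≤l , srcₐ , tgtc
      with injective (ℕ.<⇒≤ (ℕ.<-≤-trans a<c c≤l)) p≤l (trans (sym srcₐ) src≡)
         | injective c≤l q≤l (trans (sym tgtc) tgt≡)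
    ... | refl | refl = a<c , c≤l , r

    -- When `a` and `c` are joined both before and after the change, whether `f` itself is present
    -- does not affect the closure.
    toggle : ∀ {i X Y f a c} → OnPath X → a < c → c ≤ l → src f ≡ w a → tgt f ≡ w c →
      Reaches i X a c → Reaches i Y a c → AddedOrRemoved f X Y → OnPath Y × Equivalent i X Y
    toggle {i} {X} {Y} {f} {a} {c} on a<c c≤l srcₐ tgtc pX pY (inj₁ added) = on′ , XY , YX
      where
      on′ : OnPath Y
      on′ {e} e∈ with Equivalence.to (added e) e∈
      ... | inj₁ e∈X = on e∈X
      ... | inj₂ refl = a , c , a<c , c≤l , srcₐ , tgtc
      XY : Implies i (state X) (state Y)
      XY (p<q , q≤l , e , e∈ , src≡ , tgt≡) with Equivalence.to (added e) e∈
      ... | inj₁ e∈X = inj₁ (p<q , q≤l , e , e∈X , src≡ , tgt≡) ◅ ε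
      ... | inj₂ refl with injective (ℕ.<⇒≤ (ℕ.<-≤-trans a<c c≤l)) (ℕ.<⇒≤ (ℕ.<-≤-trans p<q q≤l)) (trans (sym srcₐ) src≡)
                         | injective c≤l q≤l (trans (sym tgtc) tgt≡)
      ...   | refl | refl = pX
      YX : Implies i (state Y) (state X)
      YX (p<q , q≤l , e , e∈ , eqs) = inj₁ (p<q , q≤l , e , Equivalence.from (added e) (inj₁ e∈) , eqs) ◅ ε
    toggle {i} {X} {Y} {f} {a} {c} on a<c c≤l srcₐ tgtc pX pY (inj₂ removed) =
      (λ {e} e∈ → on (proj₁ (Equivalence.to (removed e) e∈))) , XY , YX
      where
      XY : Implies i (state X) (state Y)
      XY (p<q , q≤l , e , e∈ , eqs) =
        inj₁ (p<q , q≤l , e , proj₁ (Equivalence.to (removed e) e∈) , eqs) ◅ ε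
      YX : Implies i (state Y) (state X)
      YX (p<q , q≤l , e , e∈ , src≡ , tgt≡) with e ≟ₑ f
      ... | no e≢f = inj₁ (p<q , q≤l , e , Equivalence.from (removed e) (e∈ , e≢f) , src≡ , tgt≡) ◅ ε
      ... | yes refl with injective (ℕ.<⇒≤ (ℕ.<-≤-trans a<c c≤l)) (ℕ.<⇒≤ (ℕ.<-≤-trans p<q q≤l)) (trans (sym srcₐ) src≡)
                        | injective c≤l q≤l (trans (sym tgtc) tgt≡)
      ...   | refl | refl = pY

    persists : ∀ {f : Edge N} {X Y e} → AddedOrRemoved f X Y → e ∈ₑ X → e ≢ f → e ∈ₑ Y
    persists {e = e} (inj₁ added)   e∈ _   = Equivalence.from (added e) (inj₁ e∈)
    persists {e = e} (inj₂ removed) e∈ e≢f = Equivalence.from (removed e) (e∈ , e≢f)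

    module _ {i : ℕ} {e : Edge N} (i<l : i < l) (src≡ : src e ≡ w i) (tgt≡ : tgt e ≡ w (suc i)) where

      -- The second alternative absorbs goal moves: they require `s → t` in `X`, which already joins
      -- 0 to `l`.
      move-equivalent : ∀ {X Y} → OnPath X → Move s t e X Y →
        (OnPath Y × Equivalent i X Y) ⊎ Reaches i X 0 l
      move-equivalent {X} on (see a) =
        inj₁ (toggle {X = X} on ℕ.≤-refl i<l src≡ tgt≡ (inj₂ (refl , refl) ◅ ε) (inj₂ (refl , refl) ◅ ε) a)
      move-equivalent {X} {Y} on (transitive f (g , g∈ , srcg , refl) (h , h∈ , srch , tgth) tog)
        with on g∈ | on h∈
      ... | a , b , a<b , b≤l , srcₐ , tgtb | b′ , c , b<c , c≤l , srcb , tgtc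
        with injective b≤l (ℕ.<⇒≤ (ℕ.<-≤-trans b<c c≤l)) (trans (sym tgtb) (trans (sym srch) srcb))
      ... | refl = inj₁ (toggle {X = X} on (ℕ.<-trans a<b b<c) c≤l
          (trans (sym srcg) srcₐ) (trans (sym tgth) tgtc)
          (inj₁ (a<b , b≤l , g , g∈ , srcₐ , tgtb) ◅ inj₁ (b<c , c≤l , h , h∈ , srcb , tgtc) ◅ ε)
          (inj₁ (a<b , b≤l , g , persists {Y = Y} tog g∈ g≢f , srcₐ , tgtb) ◅
           inj₁ (b<c , c≤l , h , persists {Y = Y} tog h∈ h≢f , srcb , tgtc) ◅ ε) tog)
        where
        -- The two edges composed into `f` differ from it, so they survive its removal and still
        -- derive it.
        g≢f : g ≢ f
        g≢f g≡f = ℕ.<⇒≢ b<c (injective b≤l c≤l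
          (trans (sym tgtb) (trans (cong tgt g≡f) (trans (sym tgth) tgtc))))
        h≢f : h ≢ f
        h≢f h≡f = ℕ.<⇒≢ a<b (injective (ℕ.<⇒≤ (ℕ.<-≤-trans a<b b≤l)) b≤l
          (trans (sym srcₐ) (trans srcg (trans (cong src (sym h≡f)) srcb))))
      move-equivalent {X} on (goal f (g , g∈ , srcg , tgtg) _ _) =
        inj₂ (inj₁ (edge-between {X} on (g , g∈ , trans srcg (sym start) , trans tgtg (sym end)) z≤n ℕ.≤-refl) ◅ ε)

      moves-equivalent : ∀ {X Y} → OnPath X → Star (Move s t e) X Y →
        (OnPath Y × Equivalent i X Y) ⊎ Reaches i X 0 l
      moves-equivalent on ε = inj₁ (on , (λ r → inj₁ r ◅ ε) , λ r → inj₁ r ◅ ε)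
      moves-equivalent {X} on (_◅_ {j = Z} m ms) with move-equivalent {X} on m
      ... | inj₂ reach = inj₂ reach
      ... | inj₁ (on′ , eq@(f , _)) with moves-equivalent {Z} on′ ms
      ...   | inj₂ reach = inj₂ (implies-path {X = X} {Z} f reach)
      ...   | inj₁ (on″ , eq′) = inj₁ (on″ , equivalent-trans {X = X} {Z} eq eq′)

    onPath⇒exact : ∀ {X} → OnPath X → ∀ {d} → d ≤ l → Exact 0 d (state X)
    onPath⇒exact {X} on d≤l {x} _ x≤d x∈ with toWitness {a? = mentions? X (w x)} x∈
    ... | e , e∈ , ends with on e∈
    ...   | p , q , p<q , q≤l , src≡ , tgt≡ with ends
    ...     | inj₁ srcx with injective (ℕ.<⇒≤ (ℕ.<-≤-trans p<q q≤l)) (ℕ.≤-trans x≤d d≤l) (trans (sym src≡) srcx)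
    ...       | refl = q , inj₁ (p<q , q≤l , e , e∈ , src≡ , tgt≡)
    onPath⇒exact {X} on d≤l {x} _ x≤d x∈ | e , e∈ , ends | p , q , p<q , q≤l , src≡ , tgt≡
            | inj₂ tgtx with injective q≤l (ℕ.≤-trans x≤d d≤l) (trans (sym tgt≡) tgtx)
    ...       | refl = p , inj₂ (p<q , q≤l , e , e∈ , src≡ , tgt≡)

    module _ {G′ : SwitchingNetwork N} (certain : IsCertainKnowledge s t G′) {k : ℕ} (pow<l : pow k < l) where

      open SwitchingNetwork G′ using (s′; t′; Adjacent)

      private
        K : Fin (size G′) → KnowledgeSet N
        K = proj₁ certain

        vacant : ∀ {X a} d → (∀ e → X e ≡ false) → ∣ state X ∣[ a , d ] ≡ 0
        vacant zero    empty = refl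
        vacant {X} {a} (suc d) empty with mentions? X (w (suc a))
        ... | yes (e , e∈ , _) = ⊥-elim (subst T (empty e) e∈)
        ... | no _ = vacant {X} d empty

        origin : State
        origin = state (K s′)

        uncrossed-origin : ¬ Cross 0 (pow k) origin
        uncrossed-origin (_ , _ , _ , _ , _ , _ , e , e∈ , _) = subst T (proj₁ (proj₂ certain) e) e∈

        -- Since `pow k < l`, a path from 0 to `l` leads across the first `pow k` inner positions,
        -- which is a threat after a small walk from the empty set.
        safe : ∀ {v i} → Walk 0 (pow k) k origin (state (K v)) → ¬ Reaches i (K v) 0 l
        safe {v} walk p = threat-free k 0 (vacant {K s′} (pow k) (proj₁ (proj₂ certain))) uncrossed-origin walk
          (crossing-path⇒threat 0 (pow k) (state (K v)) z≤n pow<l p)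

        won : ∀ {X u} → OnPath X → (p : ∃[ a ] (a ≤ l × u ≡ w a)) → Star (X ∋_⟶_) u t → Reaches 0 X (proj₁ p) l
        won on (a , a≤l , u≡) ε with injective a≤l ℕ.≤-refl (trans (sym u≡) (sym end))
        ... | refl = ε
        won {X} on (a , a≤l , u≡) ((e , e∈ , srcu , refl) ◅ es) with on e∈
        ... | p , q , p<q , q≤l , src≡ , tgt≡ with injective a≤l (ℕ.<⇒≤ (ℕ.<-≤-trans p<q q≤l)) (trans (sym u≡) (trans (sym srcu) src≡))
        ...   | refl = inj₁ (p<q , q≤l , e , e∈ , src≡ , tgt≡) ◅ won {X} on (q , q≤l , tgt≡) es

      crowded-vertex : Accepts G′ G → ∃[ v ] Crowded w l k (proj₁ certain v)
      crowded-vertex = go s′ (λ {e} e∈ → ⊥-elim (subst T (proj₁ (proj₂ certain) e) e∈)) ε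
        where
        go : ∀ v → OnPath (K v) → Walk 0 (pow k) k origin (state (K v)) →
             Star (λ v w → ∃[ e ] (Adjacent v e w × e ∈ₑ G)) v t′ → ∃[ v ] Crowded w l k (proj₁ certain v)
        go v on walk ε = ⊥-elim (safe {v} walk (won {K t′} on (0 , z≤n , sym start) (proj₁ (proj₂ (proj₂ certain)))))
        go v on walk (_◅_ {j = u} (e , adj , e∈) es) with edges⁻ e∈
        ... | i , i<l , src≡ , tgt≡ with moves-equivalent i<l src≡ tgt≡ on (proj₂ (proj₂ (proj₂ certain)) v e u adj)
        ...   | inj₂ p = ⊥-elim (safe {v} walk p)
        ...   | inj₁ (on′ , f , g) with ∣ state (K v) ∣[ 0 , pow k ] ℕ.≤? k | ∣ state (K u) ∣[ 0 , pow k ] ℕ.≤? k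
        ...     | no k≮ | _      = v , record { onPath = on ; many = ℕ.≰⇒> k≮ }
        ...     | yes _ | no k≮  = u , record { onPath = on′ ; many = ℕ.≰⇒> k≮ }
        ...     | yes ≤k | yes ≤k′ = go u on′ (walk ◅◅ ((small (onPath⇒exact on (ℕ.<⇒≤ pow<l)) ≤k ,
                                       small (onPath⇒exact on′ (ℕ.<⇒≤ pow<l)) ≤k′ , step i f g) ◅ ε)) es

-- Lower bound by counting layered paths

module LowerBound where

  open FiniteSearch
  open LinkNetworks
  open PathGraphs
  open LineGame
  open PathKnowledge

  hits : ∀ L → (Fin L → Bool) → ℕ
  hits zero    I = 0
  hits (suc L) I = bit (I zero) + hits L (I ∘ suc)

  misses : ∀ L → (Fin L → Bool) → ℕ
  misses zero    I = 0
  misses (suc L) I = bit (not (I zero)) + misses L (I ∘ suc)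

  hits+misses : ∀ L I → hits L I + misses L I ≡ L
  hits+misses zero    I = refl
  hits+misses (suc L) I with I zero
  ... | true  = cong suc (hits+misses L (I ∘ suc))
  ... | false = trans (ℕ.+-suc _ _) (cong suc (hits+misses L (I ∘ suc)))

  count≤hits : ∀ {S} L I a d → d ≤ L → (∀ i → T (S (suc (a + toℕ i))) → T (I i)) → count S a d ≤ hits L I
  count≤hits L I a zero _ _ = z≤n
  count≤hits {S} (suc L) I a (suc d) (s≤s d≤L) f = ℕ.+-mono-≤
    (bit-mono (λ a∈ → f zero (subst (λ p → T (S (suc p))) (sym (ℕ.+-identityʳ a)) a∈)))
    (count≤hits L (I ∘ suc) (suc a) d d≤L λ i → f (suc i) ∘ subst (λ p → T (S (suc p))) (sym (ℕ.+-suc a (toℕ i))))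

  -- The choices at the layers outside `I`, packed into a single number.
  rest : ∀ {m} L (I : Fin L → Bool) → (Fin L → Fin m) → Fin (m ℕ.^ misses L I)
  rest zero    I P = zero
  rest (suc L) I P with I zero
  ... | true  = rest L (I ∘ suc) (P ∘ suc)
  ... | false = combine (P zero) (rest L (I ∘ suc) (P ∘ suc))

  rest-injective : ∀ {m} L (I : Fin L → Bool) (P Q : Fin L → Fin m) →
    (∀ i → T (I i) → P i ≡ Q i) → rest L I P ≡ rest L I Q → ∀ i → P i ≡ Q i
  rest-injective (suc L) I P Q agree eq i with I zero in I0
  rest-injective (suc L) I P Q agree eq zero | true = agree zero (subst T (sym I0) _)
  rest-injective (suc L) I P Q agree eq (suc i) | true =
    rest-injective L (I ∘ suc) (P ∘ suc) (Q ∘ suc) (agree ∘ suc) eq i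
  rest-injective (suc L) I P Q agree eq i | false with combine-injective (P zero) _ (Q zero) _ eq
  rest-injective (suc L) I P Q agree eq zero    | false | p0 , _ = p0
  rest-injective (suc L) I P Q agree eq (suc i) | false | _ , eq′ =
    rest-injective L (I ∘ suc) (P ∘ suc) (Q ∘ suc) (agree ∘ suc) eq′ i

  append : ∀ {A : Set} L → (Fin L → A) → A → Fin (suc L) → A
  append zero    f z _       = z
  append (suc L) f z zero    = f zero
  append (suc L) f z (suc i) = append L (f ∘ suc) z i

  append-last : ∀ {A : Set} L (f : Fin L → A) z → append L f z (fromℕ L) ≡ z
  append-last zero    f z = refl
  append-last (suc L) f z = append-last L (f ∘ suc) z

  append-inject₁ : ∀ {A : Set} L (f : Fin L → A) z i → append L f z (inject₁ i) ≡ f i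
  append-inject₁ (suc L) f z zero    = refl
  append-inject₁ (suc L) f z (suc i) = append-inject₁ L (f ∘ suc) z i

  append-cases : ∀ {A : Set} L (f : Fin L → A) z i → append L f z i ≡ z ⊎ ∃[ j ] append L f z i ≡ f j
  append-cases zero    f z i       = inj₁ refl
  append-cases (suc L) f z zero    = inj₂ (zero , refl)
  append-cases (suc L) f z (suc i) = Sum.map₂ (λ (j , eq) → suc j , eq) (append-cases L (f ∘ suc) z i)

  append-injective : ∀ {A : Set} L (f : Fin L → A) z → (∀ {i j} → f i ≡ f j → i ≡ j) → (∀ i → f i ≢ z) →
    ∀ {i j} → append L f z i ≡ append L f z j → i ≡ j
  append-injective zero    f z inj ≢z {zero}  {zero}  _ = refl
  append-injective (suc L) f z inj ≢z {zero}  {zero}  _ = refl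
  append-injective (suc L) f z inj ≢z {suc i} {suc j} eq =
    cong suc (append-injective L (f ∘ suc) z (suc-injective ∘ inj) (≢z ∘ suc) eq)
  append-injective (suc L) f z inj ≢z {zero}  {suc j} eq with append-cases L (f ∘ suc) z j
  ... | inj₁ eq′ = ⊥-elim (≢z zero (trans eq eq′))
  ... | inj₂ (j′ , eq′) with () ← inj (trans eq eq′)
  append-injective (suc L) f z inj ≢z {suc i} {zero} eq with append-cases L (f ∘ suc) z i
  ... | inj₁ eq′ = ⊥-elim (≢z zero (trans (sym eq) eq′))
  ... | inj₂ (i′ , eq′) with () ← inj (trans (sym eq) eq′)

  k<pow : ∀ k → k < pow k
  k<pow zero    = s≤s z≤n
  k<pow (suc k) = ℕ.≤-trans (s≤s (k<pow k)) (ℕ.+-monoˡ-≤ (pow k) (0<pow k))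

  funToFin-cong : ∀ {L m} {P Q : Fin L → Fin m} → (∀ i → P i ≡ Q i) → funToFin P ≡ funToFin Q
  funToFin-cong {zero}  P≗Q = refl
  funToFin-cong {suc L} P≗Q = cong₂ combine (P≗Q zero) (funToFin-cong (P≗Q ∘ suc))

  module Layered {N : ℕ} {s t : Fin N} (s≢t : s ≢ t) (L m : ℕ) (Lm≤n : L ℕ.* m ≤ #V∖[ s , t ]) where

    vertex : Fin L → Fin m → Fin N
    vertex i c = interior s t (inject≤ (combine i c) Lm≤n)

    vertex-injective : ∀ {i c i′ c′} → vertex i c ≡ vertex i′ c′ → i ≡ i′ × c ≡ c′
    vertex-injective {i} {c} {i′} {c′} eq =
      combine-injective i c i′ c′ (inject≤-injective Lm≤n Lm≤n _ _ (members-injective _ eq))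

    route : (Fin L → Fin m) → Fin (suc (suc L)) → Fin N
    route P zero    = s
    route P (suc i) = append L (λ i → vertex i (P i)) t i

    route-cases : ∀ P x → route P x ≡ s ⊎ route P x ≡ t ⊎ ∃[ i ] route P x ≡ vertex i (P i)
    route-cases P zero    = inj₁ refl
    route-cases P (suc x) = inj₂ (append-cases L _ t x)

    route-injective : ∀ P {x y} → route P x ≡ route P y → x ≡ y
    route-injective P {zero}  {zero}  _ = refl
    route-injective P {suc x} {suc y} eq = cong suc (append-injective L _ t
      (proj₁ ∘ vertex-injective) (λ i → interior≢t s t _) eq)
    route-injective P {zero}  {suc y} eq = ⊥-elim (start-once y (sym eq))
      where
      start-once : ∀ y → route P (suc y) ≢ s
      start-once y eq with append-cases L (λ i → vertex i (P i)) t y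
      ... | inj₁ eq′ = s≢t (trans (sym eq) eq′)
      ... | inj₂ (i , eq′) = interior≢s s t _ (trans (sym eq′) eq)
    route-injective P {suc x} {zero} eq = sym (route-injective P {zero} {suc x} (sym eq))

    graph : (Fin L → Fin m) → InputGraph N
    graph P = graphOf (suc L) (route P)

    graph∈𝒫 : ∀ P → 𝒫 s t (suc L) (graph P)
    graph∈𝒫 P = route P , route-injective P , refl , append-last L _ t , graphOf-⇔ (suc L) (route P)

    path : ∀ P → PathGraph s t (suc L) (route P ∘ clamp (suc L)) (graph P)
    path P = proj₂ (𝒫⇒pathGraph (graph∈𝒫 P))

    module _ {G′ : SwitchingNetwork N} (certain : IsCertainKnowledge s t G′)
             (accepts : ∀ G → 𝒫 s t (suc L) G → Accepts G′ G) {k : ℕ} (pow≤L : pow k ≤ L) where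

      private
        K : Fin (size G′) → KnowledgeSet N
        K = proj₁ certain

        I : Fin (size G′) → Fin L → Bool
        I v i = ⌊ any? (λ c → mentions? (K v) (vertex i c)) ⌋

        Hit : Fin (size G′) → Fin L → Fin m → Set
        Hit v i c = ∃[ e ] (e ∈ₑ K v × (src e ≡ vertex i c ⊎ tgt e ≡ vertex i c))

        CrowdedBy : (Fin L → Fin m) → Fin (size G′) → Set
        CrowdedBy P v = Crowded (route P ∘ clamp (suc L)) (suc L) k (K v)

        -- Everything that `K v` mentions lies on the path of `P`, which meets layer `i` in the
        -- vertex chosen by `P` alone.
        hit⇒value : ∀ P {v i c} → CrowdedBy P v → Hit v i c → P i ≡ c
        hit⇒value P {v} {i} {c} crowded (e , e∈ , ends) with Crowded.onPath crowded e∈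
        ... | p , q , _ , _ , src≡ , tgt≡ =
          Sum.[ on-route (clamp (suc L) p) ∘ trans (sym src≡) , on-route (clamp (suc L) q) ∘ trans (sym tgt≡) ]′ ends
          where
          on-route : ∀ x → route P x ≡ vertex i c → P i ≡ c
          on-route x eq with route-cases P x
          ... | inj₁ eq′ = ⊥-elim (interior≢s s t _ (trans (sym eq) eq′))
          ... | inj₂ (inj₁ eq′) = ⊥-elim (interior≢t s t _ (trans (sym eq) eq′))
          ... | inj₂ (inj₂ (i′ , eq′)) with vertex-injective {i} {_} {i′} (trans (sym eq) eq′)
          ...   | refl , refl = refl

        agree : ∀ P Q {v} → CrowdedBy P v → CrowdedBy Q v → ∀ i → T (I v i) → P i ≡ Q i
        agree P Q {v} cP cQ i i∈ = let c , hit = toWitness {a? = any? (λ c → mentions? (K v) (vertex i c))} i∈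
          in trans (hit⇒value P cP hit) (sym (hit⇒value Q cQ hit))

        many-hits : ∀ P {v} → CrowdedBy P v → k < hits L (I v)
        many-hits P {v} crowded = ℕ.<-≤-trans (Crowded.many crowded) (count≤hits L (I v) 0 (pow k) pow≤L
          λ i i∈ → fromWitness (P i , subst (λ u → ∃[ e ] (e ∈ₑ K v × (src e ≡ u ⊎ tgt e ≡ u))) (at i)
            (toWitness {a? = mentions? (K v) (route P (clamp (suc L) (suc (toℕ i))))} i∈)))
          where
          at : ∀ i → route P (clamp (suc L) (suc (toℕ i))) ≡ vertex i (P i)
          at i = trans (cong (append L _ t) (clamp-inject₁ L i)) (append-inject₁ L _ t i)

        crowded : ∀ P → ∃[ v ] CrowdedBy P v
        crowded P = crowded-vertex (path P) {G′} certain {k} (s≤s pow≤L) (accepts (graph P) (graph∈𝒫 P))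

        few-misses : ∀ P {v} → CrowdedBy P v → misses L (I v) ≤ L ℕ.∸ suc k
        few-misses P {v} crowded = ℕ.≤-trans
          (ℕ.≤-reflexive (trans (sym (ℕ.m+n∸m≡n (hits L (I v)) _)) (cong (ℕ._∸ hits L (I v)) (hits+misses L (I v)))))
          (ℕ.∸-monoʳ-≤ L (many-hits P crowded))

      -- A path is encoded by a vertex crowded by it and its choices in the layers this vertex's
      -- knowledge does not mention. The remaining choices can be read off the knowledge set, so the
      -- code is injective.
      route-count : .{{ℕ.NonZero m}} → m ℕ.^ L ≤ size G′ ℕ.* m ℕ.^ (L ℕ.∸ suc k)
      route-count = injective⇒≤ {f = λ x → encode (finToFun x) (crowded (finToFun x))} λ {x} {y} eq →
        trans (sym (funToFin-finToFin {L} {m} x)) (trans (funToFin-cong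
          (encode-injective (finToFun x) (finToFun y) (crowded (finToFun x)) (crowded (finToFun y)) eq))
          (funToFin-finToFin {L} {m} y))
        where
        code : ∀ P {v} → CrowdedBy P v → Fin (m ℕ.^ (L ℕ.∸ suc k))
        code P {v} cP = inject≤ (rest L (I v) P) (ℕ.^-monoʳ-≤ m (few-misses P cP))
        encode : ∀ P → ∃[ v ] CrowdedBy P v → Fin (size G′ ℕ.* m ℕ.^ (L ℕ.∸ suc k))
        encode P (v , cP) = combine v (code P cP)
        code-injective : ∀ P Q {v u} (cP : CrowdedBy P v) (cQ : CrowdedBy Q u) →
          v ≡ u → code P cP ≡ code Q cQ → ∀ i → P i ≡ Q i
        code-injective P Q {v} cP cQ refl eq =
          rest-injective L (I v) P Q (agree P Q cP cQ) (inject≤-injective _ _ _ _ eq)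
        encode-injective : ∀ P Q cP cQ → encode P cP ≡ encode Q cQ → ∀ i → P i ≡ Q i
        encode-injective P Q (v , cP) (u , cQ) eq =
          uncurry (code-injective P Q cP cQ) (combine-injective v (code P cP) u (code Q cQ) eq)

      size-bound : m ℕ.^ suc k ≤ size G′
      size-bound with m ℕ.≟ 0
      ... | yes refl = z≤n
      ... | no m≢0 = ℕ.*-cancelʳ-≤ _ _ (m ℕ.^ (L ℕ.∸ suc k)) {{ℕ.m^n≢0 m (L ℕ.∸ suc k)}} (ℕ.≤-trans
          (ℕ.≤-reflexive (trans (sym (ℕ.^-distribˡ-+-* m (suc k) (L ℕ.∸ suc k)))
            (cong (m ℕ.^_) (ℕ.m+[n∸m]≡n (ℕ.≤-trans (k<pow k) pow≤L))))) route-count)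
        where
        instance
          m-nonZero : ℕ.NonZero m
          m-nonZero = ℕ.≢-nonZero m≢0

-- Passing to real exponents

module RealPowers where

  open LineGame using (pow; 0<pow)
  open Arithmetic

  <⇒≱ : ∀ {x y} → x ℚ.< y → ¬ (y ℚ.≤ x)
  <⇒≱ x<y y≤x = ℚ.<-irrefl refl (ℚ.<-≤-trans x<y y≤x)

  fromℕℚ-mkℚ : ∀ n → fromℕℚ n ≡ mkℚ (+ n) 0 (Coprime.sym (Coprime.1-coprimeTo n))
  fromℕℚ-mkℚ n = ℚ.normalize-coprime _

  toℚᵘ-fromℕℚ : ∀ n → toℚᵘ (fromℕℚ n) ≡ mkℚᵘ (+ n) 0
  toℚᵘ-fromℕℚ n = cong toℚᵘ (fromℕℚ-mkℚ n)

  fromℕℚ-mono-≤ : ∀ {m n} → m ℕ.≤ n → fromℕℚ m ℚ.≤ fromℕℚ n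
  fromℕℚ-mono-≤ {m} {n} m≤n rewrite fromℕℚ-mkℚ m | fromℕℚ-mkℚ n =
    ℚ.*≤* (ℤ.*-monoʳ-≤-nonNeg (+ 1) (ℤ.+≤+ m≤n))

  fromℕℚ-cancel-< : ∀ {m n} → fromℕℚ m ℚ.< fromℕℚ n → m ℕ.< n
  fromℕℚ-cancel-< m<n = ℕ.≰⇒> λ n≤m → <⇒≱ m<n (fromℕℚ-mono-≤ n≤m)

  fromℕℚ-* : ∀ m n → fromℕℚ (m ℕ.* n) ≡ fromℕℚ m ℚ.* fromℕℚ n
  fromℕℚ-* m n = ℚ.toℚᵘ-injective (ℚᵘ.≃-sym (ℚᵘ.≃-trans (ℚ.toℚᵘ-homo-* (fromℕℚ m) (fromℕℚ n)) step))
    where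
    step : toℚᵘ (fromℕℚ m) ℚᵘ.* toℚᵘ (fromℕℚ n) ℚᵘ.≃ toℚᵘ (fromℕℚ (m ℕ.* n))
    step rewrite toℚᵘ-fromℕℚ m | toℚᵘ-fromℕℚ n | toℚᵘ-fromℕℚ (m ℕ.* n) =
      ℚᵘ.*≡* (cong (ℤ._* + 1) (sym (ℤ.pos-* m n)))

  fromℕℚ-+ : ∀ m n → fromℕℚ (m ℕ.+ n) ≡ fromℕℚ m ℚ.+ fromℕℚ n
  fromℕℚ-+ m n = ℚ.toℚᵘ-injective (ℚᵘ.≃-sym (ℚᵘ.≃-trans (ℚ.toℚᵘ-homo-+ (fromℕℚ m) (fromℕℚ n)) step))
    where
    step : toℚᵘ (fromℕℚ m) ℚᵘ.+ toℚᵘ (fromℕℚ n) ℚᵘ.≃ toℚᵘ (fromℕℚ (m ℕ.+ n))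
    step rewrite toℚᵘ-fromℕℚ m | toℚᵘ-fromℕℚ n | toℚᵘ-fromℕℚ (m ℕ.+ n) =
      ℚᵘ.*≡* (cong (ℤ._* + 1) (cong₂ ℤ._+_ (ℤ.*-identityʳ (+ m)) (ℤ.*-identityʳ (+ n))))

  fromℕℚ-^ : ∀ n k → fromℕℚ (n ℕ.^ k) ≡ fromℕℚ n ^ k
  fromℕℚ-^ n zero    = refl
  fromℕℚ-^ n (suc k) = trans (fromℕℚ-* n (n ℕ.^ k)) (cong (fromℕℚ n ℚ.*_) (fromℕℚ-^ n k))

  0≤fromℕℚ : ∀ n → 0ℚ ℚ.≤ fromℕℚ n
  0≤fromℕℚ n = fromℕℚ-mono-≤ {0} {n} z≤n

  ^-nonNeg : ∀ {x} k → 0ℚ ℚ.≤ x → 0ℚ ℚ.≤ x ^ k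
  ^-nonNeg zero _ = 0≤fromℕℚ 1
  ^-nonNeg {x} (suc k) 0≤x = ℚ.nonNegative⁻¹ (x ^ suc k)
    {{ℚ.nonNeg*nonNeg⇒nonNeg x {{ℚ.nonNegative 0≤x}} (x ^ k) {{ℚ.nonNegative (^-nonNeg k 0≤x)}}}}

  ^-mono-≤ : ∀ {x y} k → 0ℚ ℚ.≤ x → x ℚ.≤ y → x ^ k ℚ.≤ y ^ k
  ^-mono-≤ zero _ _ = ℚ.≤-refl
  ^-mono-≤ {x} {y} (suc k) 0≤x x≤y = ℚ.≤-trans
    (ℚ.*-monoʳ-≤-nonNeg (x ^ k) {{ℚ.nonNegative (^-nonNeg k 0≤x)}} x≤y)
    (ℚ.*-monoˡ-≤-nonNeg y {{ℚ.nonNegative (ℚ.≤-trans 0≤x x≤y)}} (^-mono-≤ k 0≤x x≤y))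

  /-≤-fromℕℚ : ∀ {n m} d .{{_ : NonZero d}} → n ℕ.≤ d ℕ.* m → + n / d ℚ.≤ fromℕℚ m
  /-≤-fromℕℚ {n} {m} (suc d) n≤dm = ℚ.toℚᵘ-cancel-≤
    (ℚᵘ.≤-respˡ-≃ (ℚᵘ.≃-sym (ℚ.toℚᵘ-fromℚᵘ (mkℚᵘ (+ n) d))) step)
    where
    step : mkℚᵘ (+ n) d ℚᵘ.≤ toℚᵘ (fromℕℚ m)
    step rewrite toℚᵘ-fromℕℚ m = ℚᵘ.*≤* (subst₂ ℤ._≤_ (sym (ℤ.*-identityʳ (+ n)))
      (trans (cong +_ (ℕ.*-comm (suc d) m)) (ℤ.pos-* m (suc d))) (ℤ.+≤+ n≤dm))

  0≤/ : ∀ n d .{{_ : NonZero d}} → 0ℚ ℚ.≤ + n / d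
  0≤/ n d = ℚ.nonNegative⁻¹ (+ n / d) {{ℚ.normalize-nonNeg n d}}

  -- Both `x ^ j` and the power of `b` are at least 1, so their product is not below 1.
  <[]-absurd : ∀ n b j k .{{_ : NonZero n}} .{{_ : NonZero b}} {x} → fromℕℚ n ℚ.≤ x →
    ¬ ((x ^ j) <[ b ^ᶻ -[1+ k ] ])
  <[]-absurd n b j k {x} n≤x lt = <⇒≱ lt (ℚ.≤-trans
    (fromℕℚ-mono-≤ {1} {n ℕ.^ j ℕ.* b ℕ.^ suc k} (ℕ.*-mono-≤ (ℕ.m^n>0 n j) (ℕ.m^n>0 b (suc k))))
    (ℚ.≤-trans (ℚ.≤-reflexive (trans (fromℕℚ-* (n ℕ.^ j) (b ℕ.^ suc k)) (cong₂ ℚ._*_ (fromℕℚ-^ n j) (fromℕℚ-^ b (suc k)))))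
      (ℚ.*-monoʳ-≤-nonNeg (fromℕℚ b ^ suc k) {{ℚ.nonNegative (^-nonNeg (suc k) (0≤fromℕℚ b))}}
        (^-mono-≤ j (0≤fromℕℚ n) n≤x))))

  -- For a = α/β, n^β < 2^α and 2^k ≤ n give 2^(kβ) < 2^α. A negative `a` is impossible because n ≥
  -- 1.
  <lg-above : ∀ {n k} .{{_ : NonZero n}} a → pow k ℕ.≤ n → upper (lg n) a → fromℕℚ k ℚ.< a
  <lg-above {n} a pow≤n (inj₁ n≤0) =
    ⊥-elim (<⇒≱ (ℚ.*<* (ℤ.+<+ (s≤s z≤n))) (ℚ.≤-trans (fromℕℚ-mono-≤ {1} {n} (ℕ.>-nonZero⁻¹ n)) n≤0))
  <lg-above {n} (mkℚ -[1+ α ] d _) pow≤n (inj₂ lt) = ⊥-elim (<[]-absurd n 2 (suc d) α ℚ.≤-refl lt)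
  <lg-above {n} {k} (mkℚ (+ α) d _) pow≤n (inj₂ lt) rewrite fromℕℚ-mkℚ k =
    ℚ.*<* (subst₂ ℤ._<_ (ℤ.pos-* k (suc d)) (sym (ℤ.*-identityʳ (+ α))) (ℤ.+<+ kβ<α))
    where
    n^β<2^α : n ℕ.^ suc d ℕ.< 2 ℕ.^ α
    n^β<2^α = fromℕℚ-cancel-< (subst₂ ℚ._<_ (sym (fromℕℚ-^ n (suc d))) (sym (fromℕℚ-^ 2 α)) lt)
    kβ<α : k ℕ.* suc d ℕ.< α
    kβ<α = ℕ.≰⇒> λ α≤ → ℕ.<⇒≱ n^β<2^α (ℕ.≤-trans (ℕ.^-monoʳ-≤ 2 α≤) (ℕ.≤-trans
      (ℕ.≤-reflexive (sym (ℕ.^-*-assoc 2 k (suc d))))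
      (ℕ.^-monoˡ-≤ (suc d) (ℕ.≤-trans (ℕ.≤-reflexive (sym (pow≡2^ k))) pow≤n))))

  <upper-power : ∀ {n k} .{{_ : NonZero n}} x {r} → fromℕℚ k ℚ.< x → upper (n ^ℚ x) r → fromℕℚ (n ℕ.^ k) ℚ.< r
  <upper-power {n} {k} (mkℚ -[1+ ξ ] d _) k<x up rewrite fromℕℚ-mkℚ k with ℚ.drop-*<* k<x
  ... | lt rewrite sym (ℤ.pos-* k (suc d)) with () ← lt
  <upper-power {n} {k} (mkℚ (+ ξ) d _) {r} k<x (0<r , n^x<r) = ℚ.≰⇒> λ r≤ → <⇒≱ n^x<r (ℚ.≤-trans
    (^-mono-≤ (suc d) (ℚ.<⇒≤ 0<r) r≤)
    (ℚ.≤-trans (ℚ.≤-reflexive (trans (sym (fromℕℚ-^ (n ℕ.^ k) (suc d))) (cong fromℕℚ (ℕ.^-*-assoc n k (suc d)))))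
      (ℚ.≤-trans (fromℕℚ-mono-≤ (ℕ.^-monoʳ-≤ n (ℕ.<⇒≤ kη<ξ))) (ℚ.≤-reflexive (fromℕℚ-^ n ξ)))))
    where
    kη<ξ : k ℕ.* suc d ℕ.< ξ
    kη<ξ = ℤ.drop‿+<+ (subst₂ ℤ._<_ (sym (ℤ.pos-* k (suc d))) (ℤ.*-identityʳ (+ ξ))
      (ℚ.drop-*<* (subst (ℚ._< _) (fromℕℚ-mkℚ k) k<x)))

  -- A rational `q` refuting the inequality is r₁ + r₂ with r₁ above n^x for some x > k + 1 and r₂ >
  -- 2, so it already exceeds `c`.
  real-upper-bound : ∀ {n k c} .{{_ : NonZero n}} → pow k ℕ.≤ n → c ℕ.≤ 2 ℕ.+ n ℕ.^ suc k →
    fromℕᶜ c ≤ᶜ (n ^ᶜ (lg n +ᶜ fromℚ 1ℚ)) +ᶜ fromℕᶜ 2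
  real-upper-bound {n} {k} {c} pow≤n c≤
    (q , (r₁ , r₂ , (x , (a , b , lg<a , 1<b , x≡a+b) , n^x<r₁) , 2<r₂ , q≡r₁+r₂) , q<c) =
    <⇒≱ q<c (ℚ.≤-trans (fromℕℚ-mono-≤ c≤) (ℚ.≤-trans
      (ℚ.≤-reflexive (trans (cong fromℕℚ (ℕ.+-comm 2 (n ℕ.^ suc k))) (fromℕℚ-+ (n ℕ.^ suc k) 2)))
      (ℚ.≤-trans (ℚ.<⇒≤ (ℚ.+-mono-< (<upper-power {k = suc k} x k+1<x n^x<r₁) 2<r₂)) (ℚ.≤-reflexive (sym q≡r₁+r₂)))))
    where
    k+1<x : fromℕℚ (suc k) ℚ.< x
    k+1<x = subst₂ ℚ._<_ (trans (sym (fromℕℚ-+ k 1)) (cong fromℕℚ (ℕ.+-comm k 1))) (sym x≡a+b)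
      (ℚ.+-mono-< (<lg-above {k = k} a pow≤n lg<a) 1<b)

  ¼ : ℚ
  ¼ = + 1 / 4

  -- Clears denominators in p < a/4 - 1/2. Unnormalised cross-multiplication uses 8β where 4β would
  -- do, so after adding 4βρ to both sides a factor 2 is cancelled.
  exponent-bound : ∀ π r .{c : Coprime ℤ.∣ π ∣ (suc r)} α d .{c′ : Coprime ℤ.∣ α ∣ (suc d)} b →
    b ℚ.< - ½ → mkℚ π r c ≡ ¼ ℚ.* mkℚ α d c′ ℚ.+ b →
    (+ 4 ℤ.* π ℤ.* + suc d) ℤ.+ (+ 2 ℤ.* + suc d ℤ.* + suc r) ℤ.< α ℤ.* + suc r
  exponent-bound π r {c} α d {c′} b b<-½ p≡ = ℤ.*-cancelˡ-<-nonNeg (+ 2)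
    (subst₂ ℤ._<_ (lhs π (+ suc d) (+ suc r)) (rhs α (+ suc d) (+ suc r))
      (ℤ.+-monoˡ-< (+ 4 ℤ.* + suc d ℤ.* + suc r)
        (subst₂ (λ x y → π ℤ.* x ℤ.< ((+ 1 ℤ.* α) ℤ.* + 2 ℤ.+ -[1+ 0 ] ℤ.* y) ℤ.* + suc r)
          (trans (ℤ.pos-* (4 ℕ.* suc d) 2) (cong (ℤ._* + 2) (ℤ.pos-* 4 (suc d)))) (ℤ.pos-* 4 (suc d))
          (ℚᵘ.drop-*<* below))))
    where
    below : mkℚᵘ π r ℚᵘ.< mkℚᵘ (+ 1) 3 ℚᵘ.* mkℚᵘ α d ℚᵘ.+ mkℚᵘ -[1+ 0 ] 1
    below = ℚᵘ.<-respˡ-≃ (ℚᵘ.≃-sym (ℚᵘ.≃-trans (ℚ.toℚᵘ-cong p≡)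
        (ℚᵘ.≃-trans (ℚ.toℚᵘ-homo-+ (¼ ℚ.* mkℚ α d c′) b)
          (ℚᵘ.+-congˡ (toℚᵘ b) (ℚ.toℚᵘ-homo-* ¼ (mkℚ α d c′))))))
      (ℚᵘ.+-monoʳ-< (mkℚᵘ (+ 1) 3 ℚᵘ.* mkℚᵘ α d) (ℚ.toℚᵘ-mono-< b<-½))
    lhs : ∀ π β ρ → π ℤ.* (+ 4 ℤ.* β ℤ.* + 2) ℤ.+ + 4 ℤ.* β ℤ.* ρ ≡ + 2 ℤ.* (+ 4 ℤ.* π ℤ.* β ℤ.+ + 2 ℤ.* β ℤ.* ρ)
    lhs = ℤ-Solver.solve-∀
    rhs : ∀ α β ρ → ((+ 1 ℤ.* α) ℤ.* + 2 ℤ.+ -[1+ 0 ] ℤ.* (+ 4 ℤ.* β)) ℤ.* ρ ℤ.+ + 4 ℤ.* β ℤ.* ρ ≡ + 2 ℤ.* (α ℤ.* ρ)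
    rhs = ℤ-Solver.solve-∀

  -- A refutation would be some q > c below n^p with p = a/4 + b, a < lg n and b < -1/2. Once the
  -- signs of `q`, `p` and `a` are settled, it yields c^ρ < n^π, which `not-below` excludes.
  real-lower-bound : ∀ {n k c} → 2 ℕ.≤ n → 0 ℕ.< c → n ℕ.^ (2 ℕ.* k) ℕ.≤ c ℕ.^ 4 ℕ.* 4 ℕ.^ k → n ℕ.< 2 ℕ.* 4 ℕ.^ k →
    n ^ᶜ ((¼ ·ᶜ lg n) +ᶜ fromℚ (- ½)) ≤ᶜ fromℕᶜ c
  real-lower-bound {n} {k} {c} 2≤n 0<c bound n< (q , c<q , (p , (y , b , (a , a<lg , y≡) , b<-½ , p≡) , q<n^p)) =
    absurd p a q<n^p a<lg (trans p≡ (cong (ℚ._+ b) y≡))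
    where
    instance
      n-nonZero : NonZero n
      n-nonZero = ℕ.>-nonZero (ℕ.≤-trans (s≤s z≤n) 2≤n)
      c-nonZero : NonZero c
      c-nonZero = ℕ.>-nonZero 0<c
    absurd : ∀ p a → lower (n ^ℚ p) q → lower (lg n) a → p ≢ ¼ ℚ.* a ℚ.+ b
    absurd p a (inj₁ q≤0) _ _ = <⇒≱ c<q (ℚ.≤-trans q≤0 (0≤fromℕℚ c))
    absurd (mkℚ -[1+ π ] r _) a (inj₂ lt) _ _ = <[]-absurd c n (suc r) π (ℚ.<⇒≤ c<q) lt
    absurd (mkℚ (+ π) r cp) (mkℚ i d ca) (inj₂ q^ρ<n^π) 2^a<n p≡ = go i 2^a<n (subst (ℤ._< i ℤ.* + suc r)
        (cong₂ ℤ._+_ (pos-*-* 4 π (suc d)) (pos-*-* 2 (suc d) (suc r)))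
        (exponent-bound (+ π) r {cp} i d {ca} b b<-½ p≡))
      where
      pos-*-* : ∀ x y z → + x ℤ.* + y ℤ.* + z ≡ + (x ℕ.* y ℕ.* z)
      pos-*-* x y z = sym (trans (ℤ.pos-* (x ℕ.* y) z) (cong (ℤ._* + z) (ℤ.pos-* x y)))
      c^ρ<n^π : c ℕ.^ suc r ℕ.< n ℕ.^ π
      c^ρ<n^π = fromℕℚ-cancel-< (ℚ.≤-<-trans
        (ℚ.≤-trans (ℚ.≤-reflexive (fromℕℚ-^ c (suc r))) (^-mono-≤ (suc r) (0≤fromℕℚ c) (ℚ.<⇒≤ c<q)))
        (subst (q ^ suc r ℚ.<_) (sym (fromℕℚ-^ n π)) q^ρ<n^π))
      go : ∀ i → 0ℚ ℚ.< fromℕℚ n × [ 2 ^ᶻ i ]< (fromℕℚ n ^ suc d) →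
        + (4 ℕ.* π ℕ.* suc d ℕ.+ 2 ℕ.* suc d ℕ.* suc r) ℤ.< i ℤ.* + suc r → ⊥
      go (+ α) (_ , 2^α<n^β) lt = not-below {k = k} 2≤n 0<c bound n< α (suc d) π (suc r)
        (fromℕℚ-cancel-< (subst₂ ℚ._<_ (sym (fromℕℚ-^ 2 α)) (sym (fromℕℚ-^ n (suc d))) 2^α<n^β))
        (ℕ.<⇒≤ (ℤ.drop‿+<+ (subst (_ ℤ.<_) (sym (ℤ.pos-* α (suc r))) lt))) c^ρ<n^π
      -- A negative `a` would make `p` negative.
      go -[1+ α ] _ ()

-- Assembly of the four bounds

open LinkNetworks
open PathGraphs
open UpperBound
open LowerBound
open LineGame using (pow; 0<pow)
open Arithmetic
open RealPowers

module _ {N : ℕ} {s t : Fin N} {I J : Pred (InputGraph N) 0ℓ} where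

  solvable-⊆ : ∀ {m} → I ⊆ J → Solvable s t J m → Solvable s t I m
  solvable-⊆ I⊆J (K , s′ , t′ , empty , path , acc) = K , s′ , t′ , empty , path , λ G G∈I → acc G (I⊆J G∈I)

  IsC-mono : ∀ {a b} → I ⊆ J → IsC s t I a → IsC s t J b → a ℕ.≤ b
  IsC-mono I⊆J isA isB with IsC.attained isB
  ... | G′ , certain , acc , refl = IsC.minimal isA G′ certain λ G G∈I → acc G (I⊆J G∈I)

module _ {N : ℕ} {s t : Fin N} (s≢t : s ≢ t) where

  private
    n : ℕ
    n = #V∖[ s , t ]

  c≤-exists : ∀ l → ∃[ c ] (IsC s t (𝒫≤ s t l) c × c ℕ.≤ 2 ℕ.+ n ℕ.^ ⌈log₂ l ⌉)
  c≤-exists l = c-exists s t (𝒫≤ s t l) (𝒫≤-dec s t l) 𝒫≤-resp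
    (Pebbling.solvable s t s≢t ⌈log₂ l ⌉ (≤pow-log l))

  -- Writing the rounded logarithm as k + 1 makes `k` the largest exponent with 2^k ≤ L, the range
  -- allowed by `size-bound`; each layer receives `n / L` vertices.
  quotient-bound : ∀ {I : Pred (InputGraph N) 0ℓ} {c} L .{{_ : NonZero L}} → 𝒫 s t (suc L) ⊆ I → IsC s t I c →
    (n ℕ./ L) ℕ.^ ⌈log₂ suc L ⌉ ℕ.≤ c
  quotient-bound {c = c} L 𝒫⊆I isC = bound ⌈log₂ suc L ⌉ refl (IsC.attained isC)
    where
    bound : ∀ κ → κ ≡ ⌈log₂ suc L ⌉ →
      ∃[ G′ ] (IsCertainKnowledge s t G′ × (∀ G → _ → Accepts G′ G) × size G′ ≡ c) → (n ℕ./ L) ℕ.^ κ ℕ.≤ c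
    bound zero 0≡log _ = ⊥-elim (ℕ.<⇒≢ (0<log₂ (s≤s (ℕ.>-nonZero⁻¹ L))) 0≡log)
    bound (suc k) eq (G′ , certain , acc , refl) = Layered.size-bound s≢t L (n ℕ./ L)
      (ℕ.≤-trans (ℕ.≤-reflexive (ℕ.*-comm L (n ℕ./ L))) (m/n*n≤m n L)) {G′} certain
      (λ G G∈ → acc G (𝒫⊆I G∈)) {k} (ℕ.s≤s⁻¹ (pow<⇐<log {k} (ℕ.≤-reflexive eq)))

  all-lower-bound : ∀ {c} → 2 ℕ.≤ n → IsC s t (𝒫-all s t) c →
    n ^ᶜ ((¼ ·ᶜ lg n) +ᶜ fromℚ (- ½)) ≤ᶜ fromℕᶜ c
  all-lower-bound {c} 2≤n isC with half-root n
  ... | zero , _ , n<2 = ⊥-elim (ℕ.<⇒≱ n<2 2≤n)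
  ... | r@(suc _) , 2r²≤n , n< = real-lower-bound {n} {K} {c} 2≤n 0<c
    (fourth-power-bound c n r K {{n-nonZero}} 2r²≤n n^K≤) n<2·4^K
    where
    open ℕ.≤-Reasoning
    K m : ℕ
    K = ⌈log₂ suc r ⌉
    m = n ℕ./ r
    n-nonZero : NonZero n
    n-nonZero = ℕ.>-nonZero (ℕ.≤-trans (s≤s z≤n) 2≤n)
    r≤n : r ℕ.≤ n
    r≤n = ℕ.≤-trans (ℕ.m≤m*n r r) (ℕ.≤-trans (ℕ.m≤n*m (r ℕ.* r) 2) 2r²≤n)
    m^K≤c : m ℕ.^ K ℕ.≤ c
    m^K≤c = quotient-bound r (λ G∈ → suc r , s≤s z≤n ,
      ℕ.≤-trans (s≤s r≤n) (ℕ.≤-reflexive (ℕ.+-comm 1 n)) , G∈) isC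
    0<c : 0 ℕ.< c
    0<c = ℕ.≤-trans (ℕ.m^n>0 m {{ℕ.>-nonZero (m≥n⇒m/n>0 r≤n)}} K) m^K≤c
    n^K≤ : n ℕ.^ K ℕ.≤ c ℕ.* (2 ℕ.* r) ℕ.^ K
    n^K≤ = begin
      n ℕ.^ K                        ≤⟨ ℕ.^-monoˡ-≤ K (n≤2L[n/L] n r r≤n) ⟩
      (2 ℕ.* r ℕ.* m) ℕ.^ K          ≡⟨ ^-distribʳ-* (2 ℕ.* r) m K ⟩
      (2 ℕ.* r) ℕ.^ K ℕ.* m ℕ.^ K    ≡⟨ ℕ.*-comm ((2 ℕ.* r) ℕ.^ K) (m ℕ.^ K) ⟩
      m ℕ.^ K ℕ.* (2 ℕ.* r) ℕ.^ K    ≤⟨ ℕ.*-monoˡ-≤ ((2 ℕ.* r) ℕ.^ K) m^K≤c ⟩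
      c ℕ.* (2 ℕ.* r) ℕ.^ K          ∎
    1+r≤2^K : suc r ℕ.≤ 2 ℕ.^ K
    1+r≤2^K = ℕ.≤-trans (≤pow-log (suc r)) (ℕ.≤-reflexive (pow≡2^ K))
    n<2·4^K : n ℕ.< 2 ℕ.* 4 ℕ.^ K
    n<2·4^K = begin-strict
      n                              <⟨ n< ⟩
      2 ℕ.* (suc r ℕ.* suc r)        ≤⟨ ℕ.*-monoʳ-≤ 2 (ℕ.*-mono-≤ 1+r≤2^K 1+r≤2^K) ⟩
      2 ℕ.* (2 ℕ.^ K ℕ.* 2 ℕ.^ K)    ≡⟨ cong (2 ℕ.*_) (^-distribʳ-* 2 2 K) ⟨
      2 ℕ.* 4 ℕ.^ K                  ∎

  -- Rounding up costs at most 1 in the exponent: if ⌈lg (n + 1)⌉ = k + 1, then 2^k < n + 1, hence k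
  -- ≤ lg n.
  all-upper-bound : ∀ {c} → 2 ℕ.≤ n → c ℕ.≤ 2 ℕ.+ n ℕ.^ ⌈log₂ (n ℕ.+ 1) ⌉ →
    fromℕᶜ c ≤ᶜ (n ^ᶜ (lg n +ᶜ fromℚ 1ℚ)) +ᶜ fromℕᶜ 2
  all-upper-bound {c} 2≤n c≤ with ⌈log₂ (n ℕ.+ 1) ⌉ in eq
  ... | zero = ⊥-elim (ℕ.<⇒≢ (0<log₂ {n ℕ.+ 1} (ℕ.≤-trans 2≤n (ℕ.m≤m+n n 1))) (sym eq))
  ... | suc k = real-upper-bound {n} {k} {c} {{ℕ.>-nonZero (ℕ.≤-trans (s≤s z≤n) 2≤n)}}
    (ℕ.s≤s⁻¹ (ℕ.≤-trans (pow<⇐<log {k} (ℕ.≤-reflexive (sym eq))) (ℕ.≤-reflexive (ℕ.+-comm n 1)))) c≤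

theorem2p2 : (N : ℕ) (s t : Fin N) → s ≢ t →
    (l : ℕ) (2≤l : 2 ℕ.≤ l) →
    let n = #V∖[ s , t ] in
    2 ℕ.* (l ℕ.∸ 1) ℕ.^ 2 ℕ.≤ n →
    ∃[ c₁ ] ∃[ c₂ ] ∃[ c₃ ]
    (IsC s t (𝒫 s t l) c₁ × IsC s t (𝒫≤ s t l) c₂ × IsC s t (𝒫-all s t) c₃ ×
    ((_/_ (+ n) (2 ℕ.* (l ℕ.∸ 1)) {{2[l-1]-nonZero 2≤l}}) ^ ⌈log₂ l ⌉ ℚ.≤ fromℕℚ c₁ ×
    c₁ ℕ.≤ c₂ ×
    c₂ ℕ.≤ n ℕ.^ ⌈log₂ l ⌉ ℕ.+ 2) ×
    (n ^ᶜ (((+ 1 / 4) ·ᶜ lg n) +ᶜ fromℚ (- ½)) ≤ᶜ fromℕᶜ c₃ ×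
    fromℕᶜ c₃ ≤ᶜ (n ^ᶜ (lg n +ᶜ fromℚ 1ℚ)) +ᶜ fromℕᶜ 2))
theorem2p2 N s t s≢t l@(suc L@(suc _)) (s≤s (s≤s z≤n)) 2L²≤n =
  c₁ , c₂ , c₃ , isC₁ , isC₂ , isC₃ ,
  (lower₁ , IsC-mono 𝒫⊆𝒫≤ isC₁ isC₂ , ℕ.≤-trans c₂≤ (ℕ.≤-reflexive (ℕ.+-comm 2 (n ℕ.^ ⌈log₂ l ⌉)))) ,
  (all-lower-bound s≢t 2≤n isC₃ , all-upper-bound s≢t 2≤n c₃≤)
  where
  n : ℕ
  n = #V∖[ s , t ]
  𝒫⊆𝒫≤ : 𝒫 s t l ⊆ 𝒫≤ s t l
  𝒫⊆𝒫≤ G∈ = l , s≤s z≤n , ℕ.≤-refl , G∈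
  ex₁ : ∃[ c ] (IsC s t (𝒫 s t l) c × c ℕ.≤ 2 ℕ.+ n ℕ.^ ⌈log₂ l ⌉)
  ex₁ = c-exists s t (𝒫 s t l) (𝒫-dec s t l) 𝒫-resp
    (solvable-⊆ 𝒫⊆𝒫≤ (Pebbling.solvable s t s≢t ⌈log₂ l ⌉ (≤pow-log l)))
  ex₂ : ∃[ c ] (IsC s t (𝒫≤ s t l) c × c ℕ.≤ 2 ℕ.+ n ℕ.^ ⌈log₂ l ⌉)
  ex₂ = c≤-exists s≢t l
  ex₃ : ∃[ c ] (IsC s t (𝒫-all s t) c × c ℕ.≤ 2 ℕ.+ n ℕ.^ ⌈log₂ (n ℕ.+ 1) ⌉)
  ex₃ = c≤-exists s≢t (n ℕ.+ 1)
  c₁ c₂ c₃ : ℕ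
  c₁ = proj₁ ex₁
  c₂ = proj₁ ex₂
  c₃ = proj₁ ex₃
  isC₁ : IsC s t (𝒫 s t l) c₁
  isC₁ = proj₁ (proj₂ ex₁)
  isC₂ : IsC s t (𝒫≤ s t l) c₂
  isC₂ = proj₁ (proj₂ ex₂)
  c₂≤ : c₂ ℕ.≤ 2 ℕ.+ n ℕ.^ ⌈log₂ l ⌉
  c₂≤ = proj₂ (proj₂ ex₂)
  isC₃ : IsC s t (𝒫-all s t) c₃
  isC₃ = proj₁ (proj₂ ex₃)
  c₃≤ : c₃ ℕ.≤ 2 ℕ.+ n ℕ.^ ⌈log₂ (n ℕ.+ 1) ⌉
  c₃≤ = proj₂ (proj₂ ex₃)
  2≤n : 2 ℕ.≤ n
  2≤n = ℕ.≤-trans (ℕ.*-monoʳ-≤ 2 (ℕ.m^n>0 L 2)) 2L²≤n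
  L≤n : L ℕ.≤ n
  L≤n = ℕ.≤-trans (ℕ.m≤m*n L (L ℕ.* 1)) (ℕ.≤-trans (ℕ.m≤n*m (L ℕ.^ 2) 2) 2L²≤n)
  lower₁ : (+ n / (2 ℕ.* L)) ^ ⌈log₂ l ⌉ ℚ.≤ fromℕℚ c₁
  -- The 2 in the denominator pays for rounding n/L down to the integer layer size.
  lower₁ = ℚ.≤-trans
    (^-mono-≤ ⌈log₂ l ⌉ (0≤/ n (2 ℕ.* L)) (/-≤-fromℕℚ {n} {n ℕ./ L} (2 ℕ.* L) (n≤2L[n/L] n L L≤n)))
    (ℚ.≤-trans (ℚ.≤-reflexive (sym (fromℕℚ-^ (n ℕ./ L) ⌈log₂ l ⌉)))
      (fromℕℚ-mono-≤ (quotient-bound s≢t L (λ G∈ → G∈) isC₁)))
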